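{- Let $G$ be a connected unicyclic graph with largest vertex degree $\Delta=3$ and let $\alpha\in(0,1)$. If $k(G)=3$ and $\alpha>\frac{ -\gamma_0}{2-\gamma_0}$, or if $k(G)=2$ and $\alpha>\frac{ -\delta_0}{2-\delta_0}$, then \[ \rho(A_\alpha(G))<3\alpha+2(1-\alpha)\sqrt{2}\cos\frac{\pi}{2k(G)+1}. \]
   Context: $A_\alpha(G)=\alpha D(G)+(1-\alpha)A(G)$ ($D$ degree matrix, $A$ adjacency matrix), and $\rho(M)$ is the spectral radius (largest eigenvalue) of a symmetric matrix $M$. A unicyclic graph is a connected graph with exactly one cycle; if $C_r$ is its cycle with vertices $v_1,\dots,v_r$, removing the cycle edges leaves trees $T_1,\dots,T_r$ rooted at $v_1,\dots,v_r$, $h(T_i)$ is the largest distance from $v_i$ to a vertex of $T_i$, and $k(G)=\max_i h(T_i)+1$. Let $Z(\gamma)=\begin{pmatrix}\gamma&\sqrt2&0\\ \sqrt2&0&1\\ 0&1&2\end{pmatrix}$ and $W(\delta)=\begin{pmatrix}\delta&1\\1&2\end{pmatrix}$. $\gamma_0$ is the unique real number (it lies in $(-0.25,-0.2)$) with $\rho(Z(\gamma_0))=2\sqrt2\cos\frac{\pi}{7}$, and $\delta_0$ is the unique real number (it lies in $(-1.2,-1.1)$) with $\rho(W(\delta_0))=2\sqrt2\cos\frac{\pi}{5}$. -}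

module Defs where

open import Level using (Level; _⊔_; 0ℓ) renaming (suc to lsuc)
open import Algebra.Core using (Op₁; Op₂)
open import Algebra.Bundles using (CommutativeRing; Semiring)
open import Algebra.Structures using (IsCommutativeRing)
import Algebra.Definitions.RawSemiring as RawSemiringDefinitions
open import Data.Bool.Base using (if_then_else_)
open import Data.Fin.Base using (Fin; toℕ)
open import Data.Fin.Properties using (any?) renaming (_≟_ to _≟ᶠ_)
open import Data.List.Base using (length; filter; allFin)
open import Data.Nat.Base as ℕ using (ℕ; suc; _!)
open import Data.Nat.DivMod using (_mod_)
open import Data.Product.Base using (_×_; _,_; ∃; ∃-syntax; proj₁)
open import Data.Sum.Base as Sum using (_⊎_)
open import Data.Vec.Functional as Vector using (Vector; []; _∷_)
open import Function.Base using (_∘_)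
open import Function.Bundles using (_⇔_)
open import Function.Definitions using (Injective)
open import Relation.Binary.Core using (Rel)
open import Relation.Binary.Construct.Closure.ReflexiveTransitive using (Star)
open import Relation.Binary.Definitions using (Symmetric; Irreflexive; Decidable)
open import Relation.Binary.PropositionalEquality.Core using (_≡_)
open import Relation.Binary.Structures using (IsStrictTotalOrder)
open import Relation.Nullary using (¬_; does)
open import Relation.Nullary.Decidable using (_×-dec_; _⊎-dec_; ¬?)

------------------------------------------------------------------------
-- The real numbers

-- Dedekind-complete ordered fields.  Classically these are exactly the
-- isomorphic copies of ℝ, so a theorem about an arbitrary one is a
-- theorem about ℝ.

record CompleteOrderedField (c ℓ₁ ℓ₂ : Level) : Set (lsuc (c ⊔ ℓ₁ ⊔ ℓ₂)) where
  infix  9 _⁻¹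
  infix  8 -_
  infixl 7 _*_ _/_
  infixl 6 _+_ _-_
  infix  4 _≈_ _<_ _≤_

  field
    Carrier : Set c
    _≈_     : Rel Carrier ℓ₁
    _<_     : Rel Carrier ℓ₂
    _+_     : Op₂ Carrier
    _*_     : Op₂ Carrier
    -_      : Op₁ Carrier
    0#      : Carrier
    1#      : Carrier
    -- Total, as is usual for division in proof assistants; nothing is
    -- assumed about the value at 0#.
    _⁻¹     : Op₁ Carrier

  _≤_ : Rel Carrier (ℓ₁ ⊔ ℓ₂)
  x ≤ y = x < y ⊎ x ≈ y

  IsUpperBound : ∀ {p} → (Carrier → Set p) → Carrier → Set (c ⊔ ℓ₁ ⊔ ℓ₂ ⊔ p)
  IsUpperBound P b = ∀ x → P x → x ≤ b

  IsSupremum : ∀ {p} → (Carrier → Set p) → Carrier → Set (c ⊔ ℓ₁ ⊔ ℓ₂ ⊔ p)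
  IsSupremum P s = IsUpperBound P s × (∀ b → IsUpperBound P b → s ≤ b)

  field
    isCommutativeRing  : IsCommutativeRing _≈_ _+_ _*_ -_ 0# 1#
    isStrictTotalOrder : IsStrictTotalOrder _≈_ _<_
    0<1                : 0# < 1#
    +-monoˡ-<          : ∀ z {x y} → x < y → x + z < y + z
    *-pos              : ∀ {x y} → 0# < x → 0# < y → 0# < x * y
    *-inverseʳ         : ∀ x → ¬ x ≈ 0# → x * x ⁻¹ ≈ 1#
    complete           : (P : Carrier → Set (c ⊔ ℓ₁ ⊔ ℓ₂)) →
                         ∃ P → ∃ (IsUpperBound P) → ∃ (IsSupremum P)

  commutativeRing : CommutativeRing c ℓ₁
  commutativeRing = record { isCommutativeRing = isCommutativeRing }

  open RawSemiringDefinitions (Semiring.rawSemiring (CommutativeRing.semiring commutativeRing)) public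
    using (sum; _^_) renaming (_×_ to _·_)

  _-_ : Op₂ Carrier
  x - y = x + (- y)

  _/_ : Op₂ Carrier
  x / y = x * y ⁻¹

  fromℕ : ℕ → Carrier
  fromℕ n = n · 1#

------------------------------------------------------------------------
-- √, cos and π

module Analysis {c ℓ₁ ℓ₂} (ℝ : CompleteOrderedField c ℓ₁ ℓ₂) where
  open CompleteOrderedField ℝ

  IsSqrt : Carrier → Carrier → Set (ℓ₁ ⊔ ℓ₂)
  IsSqrt x s = 0# ≤ s × s * s ≈ x

  _ConvergesTo_ : (ℕ → Carrier) → Carrier → Set (c ⊔ ℓ₂)
  a ConvergesTo l = ∀ ε → 0# < ε → ∃[ N ] ∀ n → N ℕ.≤ n →
    l - ε < a n × a n < l + ε

  cosTerm : Carrier → ℕ → Carrier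
  cosTerm x j = (- 1#) ^ j * x ^ (2 ℕ.* j) / fromℕ ((2 ℕ.* j) !)

  cosPartialSum : Carrier → ℕ → Carrier
  cosPartialSum x n = sum {n} (cosTerm x ∘ toℕ)

  IsCosine : (Carrier → Carrier) → Set (c ⊔ ℓ₂)
  IsCosine cos = ∀ x → cosPartialSum x ConvergesTo cos x

  -- π / 2 is the least positive zero of the cosine.
  IsPi : (Carrier → Carrier) → Carrier → Set (c ⊔ ℓ₁ ⊔ ℓ₂)
  IsPi cos π = 0# < π
             × cos (π / fromℕ 2) ≈ 0#
             × (∀ x → 0# < x → x < π / fromℕ 2 → ¬ cos x ≈ 0#)

------------------------------------------------------------------------
-- Matrices and the spectral radius

module Spectral {c ℓ₁ ℓ₂} (ℝ : CompleteOrderedField c ℓ₁ ℓ₂) where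
  open CompleteOrderedField ℝ

  Matrix : ℕ → Set c
  Matrix n = Fin n → Fin n → Carrier

  IsEigenvalue : ∀ {n} → Matrix n → Carrier → Set (c ⊔ ℓ₁)
  IsEigenvalue {n} M μ = ∃ λ (x : Vector Carrier n) →
      (∃[ i ] ¬ x i ≈ 0#)
    × (∀ (i : Fin n) → sum (λ j → M i j * x j) ≈ μ * x i)

  -- The largest eigenvalue; it is only used for symmetric M, all of whose
  -- eigenvalues are real.
  IsSpectralRadius : ∀ {n} → Matrix n → Carrier → Set (c ⊔ ℓ₁ ⊔ ℓ₂)
  IsSpectralRadius M ρ = IsEigenvalue M ρ × (∀ μ → IsEigenvalue M μ → μ ≤ ρ)

  Z : (√2 γ : Carrier) → Matrix 3
  Z √2 γ = (γ  ∷ √2 ∷ 0#      ∷ [])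
         ∷ (√2 ∷ 0# ∷ 1#      ∷ [])
         ∷ (0# ∷ 1# ∷ fromℕ 2 ∷ [])
         ∷ []

  W : (δ : Carrier) → Matrix 2
  W δ = (δ  ∷ 1#      ∷ [])
      ∷ (1# ∷ fromℕ 2 ∷ [])
      ∷ []

------------------------------------------------------------------------
-- Finite simple graphs

record Graph (n : ℕ) : Set₁ where
  infix 4 _~_ _~?_
  field
    _~_    : Rel (Fin n) 0ℓ
    _~?_   : Decidable _~_
    sym    : Symmetric _~_
    irrefl : Irreflexive _≡_ _~_

module _ {n : ℕ} (G : Graph n) where
  open Graph G

  degree : Fin n → ℕ
  degree u = length (filter (u ~?_) (allFin n))

  maxDegree : ℕ
  maxDegree = Vector.foldr ℕ._⊔_ 0 degree

  Connected : Set
  Connected = ∀ u v → Star _~_ u v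

  data Walk : Fin n → Fin n → ℕ → Set where
    nil  : ∀ {u} → Walk u u 0
    cons : ∀ {u v w d} → u ~ v → Walk v w d → Walk u w (suc d)

  IsDistance : Fin n → Fin n → ℕ → Set
  IsDistance u v d = Walk u v d × (∀ d′ → Walk u v d′ → d ℕ.≤ d′)

  -- The largest distance from u to a vertex of its connected component:
  -- only vertices reachable from u have a distance from u.
  IsHeight : Fin n → ℕ → Set
  IsHeight u h = (∃[ v ] IsDistance u v h)
               × (∀ v d → IsDistance u v d → d ℕ.≤ h)

next : ∀ {r} → Fin (suc r) → Fin (suc r)
next {r} i = suc (toℕ i) mod suc r

record Cycle {n} (G : Graph n) : Set where
  open Graph G
  field
    m         : ℕ

  r : ℕ
  r = 3 ℕ.+ m

  field
    vertex    : Fin r → Fin n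
    injective : Injective _≡_ _≡_ vertex
    adjacent  : ∀ i → vertex i ~ vertex (next i)

  Edge : Rel (Fin n) 0ℓ
  Edge u v = ∃[ i ] ((u ≡ vertex i × v ≡ vertex (next i))
                   ⊎ (v ≡ vertex i × u ≡ vertex (next i)))

  edge? : Decidable Edge
  edge? u v = any? λ i →
      ((u ≟ᶠ vertex i) ×-dec (v ≟ᶠ vertex (next i)))
    ⊎-dec
      ((v ≟ᶠ vertex i) ×-dec (u ≟ᶠ vertex (next i)))

  edge-sym : Symmetric Edge
  edge-sym (i , e) = i , Sum.swap e

removeCycleEdges : ∀ {n} (G : Graph n) → Cycle G → Graph n
removeCycleEdges G C = record
  { _~_    = λ u v → (u ~ v) × ¬ Edge u v
  ; _~?_   = λ u v → (u ~? v) ×-dec ¬? (edge? u v)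
  ; sym    = λ (u~v , ∉C) → sym u~v , ∉C ∘ edge-sym
  ; irrefl = λ u≡v → irrefl u≡v ∘ proj₁
  }
  where
  open Graph G
  open Cycle C

-- A Cycle carries a starting vertex and an orientation; as subgraphs, two
-- cycles are the same when they have the same edges.

record IsUnicyclic {n} (G : Graph n) : Set where
  field
    connected : Connected G
    cycle     : Cycle G
    unique    : ∀ (C : Cycle G) u v → Cycle.Edge C u v ⇔ Cycle.Edge cycle u v

  open Cycle cycle public using (r; vertex)

-- IsK U k says k = k(G).  The tree Tᵢ is the component of vertex i after
-- removal of the cycle edges, and h i is its height.

IsK : ∀ {n} {G : Graph n} → IsUnicyclic G → ℕ → Set
IsK {G = G} U k = ∃[ h ]
    (∀ (i : Fin r) → IsHeight (removeCycleEdges G cycle) (vertex i) (h i))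
  × k ≡ Vector.foldr ℕ._⊔_ 0 h ℕ.+ 1
  where open IsUnicyclic U

module AαMatrix {c ℓ₁ ℓ₂} (ℝ : CompleteOrderedField c ℓ₁ ℓ₂) where
  open CompleteOrderedField ℝ
  open Spectral ℝ using (Matrix)

  degreeMatrix : ∀ {n} → Graph n → Matrix n
  degreeMatrix G i j = if does (i ≟ᶠ j) then fromℕ (degree G i) else 0#

  adjacencyMatrix : ∀ {n} → Graph n → Matrix n
  adjacencyMatrix G i j = if does (i ~? j) then 1# else 0#
    where open Graph G

  Aα : ∀ {n} → Carrier → Graph n → Matrix n
  Aα α G i j = α * degreeMatrix G i j + (1# - α) * adjacencyMatrix G i j

module Submission where

-- Write s = α / (1 - α) and t = 2√2 cos (π / (2k + 1)), so that the bound reads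
-- 3α + (1 - α) t.  A positive vector x with A x + s D x < (t + 3s) x in every
-- coordinate bounds all eigenvalues of Aα = (1 - α) (A + s D) strictly by this
-- number.  Let x depend on the distance to the cycle only.  Since the cycle is
-- unique, every edge lies on it or joins a vertex to the next one on its way to
-- the cycle; hence x need only solve one inequality per distance 0, …, k - 1,
-- the extreme case being that of vertices of degree 3, with leaves at distance
-- k - 1.  The matrix of that system is, after symmetrisation, Z (- 2s) or
-- W (- 2s), and the hypothesis on α says that - 2s < γ₀ or - 2s < δ₀; as t is
-- the spectral radius of Z γ₀ or W δ₀, there is room for a strict solution.

open import Defs
open import Algebra.Bundles using (CommutativeRing)
import Algebra.Properties.Ring as RingProperties
import Algebra.Properties.Semiring.Mult as Mult
import Algebra.Properties.Semiring.Sum as SemiringSum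
import Algebra.Solver.Ring
open import Algebra.Solver.Ring.AlmostCommutativeRing
  using (_-Raw-AlmostCommutative⟶_; fromCommutativeRing)
open import Data.Bool.Base using (if_then_else_; true; false)
open import Data.Empty using (⊥; ⊥-elim)
open import Data.Fin.Base as Fin using (Fin; zero; suc; toℕ; inject₁)
open import Data.Fin.Induction using (<-weakInduction)
import Data.Fin.Properties as Fin
open import Data.Fin.Relation.Unary.Top using (view; ‵fromℕ; ‵inject₁)
open import Data.Integer.Base as ℤ using (ℤ; +_; -[1+_])
import Data.Integer.Properties as ℤ
open import Data.List.Base
  using (List; []; _∷_; length; lookup; map; replicate; filter; tabulate; foldr; allFin)
import Data.List.Membership.DecPropositional as DecMembership
open import Data.List.Membership.Propositional using (_∈_)
open import Data.List.Membership.Propositional.Properties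
  using (∈-filter⁺; ∈-filter⁻; ∈-allFin; ∈-lookup)
open import Data.List.Properties using (length-map; map-∘)
open import Data.List.Relation.Binary.Permutation.Propositional
  using (_↭_; ↭-refl; ↭-sym; ↭-trans; prep; swap)
open import Data.List.Relation.Binary.Permutation.Propositional.Properties
  using (All-resp-↭; ∈-resp-↭; ↭-length; map⁺)
open import Data.List.Relation.Unary.All as All using (All; []; _∷_)
import Data.List.Relation.Unary.All.Properties as All
open import Data.List.Relation.Unary.AllPairs using ([]; _∷_)
open import Data.List.Relation.Unary.Any using (here; there)
open import Data.List.Relation.Unary.Unique.Propositional using (Unique)
open import Data.List.Relation.Unary.Unique.Propositional.Properties using (allFin⁺; filter⁺)
open import Data.Maybe.Base using (Maybe; just; nothing)
open import Data.Nat.Base as ℕ using (ℕ; zero; suc)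
open import Data.Nat.DivMod using (m<n⇒m%n≡m; n%n≡0; m%n<n; _%_)
import Data.Nat.Properties as ℕ
open import Data.Product.Base using (_×_; _,_; ∃; proj₁; proj₂)
open import Data.Sum.Base using (_⊎_; inj₁; inj₂; [_,_]′)
import Data.Vec.Functional as Vector
open Vector using () renaming ([] to []ᵛ; _∷_ to _∷ᵛ_)
open import Function.Base using (_∘_; id)
open import Function.Bundles using (module Equivalence)
open import Level using (0ℓ; _⊔_; Lift; lift)
import Relation.Binary.Reasoning.Setoid as SetoidReasoning
open import Relation.Binary.Construct.Closure.ReflexiveTransitive as Star
  using (Star; ε; _◅_; _◅◅_)
open import Relation.Binary.Core using (Rel)
open import Relation.Binary.Definitions using (Symmetric; tri<; tri≈; tri>)
open import Relation.Binary.PropositionalEquality as ≡ using (_≡_; _≢_)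
open import Relation.Binary.Structures using (IsStrictTotalOrder)
open import Relation.Nullary using (¬_; Dec; yes; no; does)
open import Relation.Nullary.Decidable using (_×-dec_; _⊎-dec_)
open import Relation.Unary using (Pred; Decidable)

-- Distances to the cycle of a unicyclic graph

module UnicyclicGraphs where
  open ≡ using (refl; sym; trans; cong; subst; ≢-sym)

  -- Least witnesses and duplicate-free lists

  least : (P : ℕ → Set) → (∀ j → Dec (P j)) → ∀ m → P m →
          ∃ λ j → P j × (∀ i → P i → j ℕ.≤ i)
  least P P? m Pm with P? 0
  ... | yes P0 = 0 , P0 , λ _ _ → ℕ.z≤n
  least P P? zero    P0 | no ¬P0 = ⊥-elim (¬P0 P0)
  least P P? (suc m) Pm | no ¬P0 with least (P ∘ suc) (P? ∘ suc) m Pm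
  ... | j , Pj , minimal = suc j , Pj , λ where
    zero    P0 → ⊥-elim (¬P0 P0)
    (suc i) Pi → ℕ.s≤s (minimal i Pi)

  ≤-foldr-⊔ : ∀ {n} (f : Fin n → ℕ) i → f i ℕ.≤ Vector.foldr ℕ._⊔_ 0 f
  ≤-foldr-⊔ f zero    = ℕ.m≤m⊔n _ _
  ≤-foldr-⊔ f (suc i) = ℕ.≤-trans (≤-foldr-⊔ (f ∘ suc) i) (ℕ.m≤n⊔m (f zero) _)

  module _ {A : Set} where
    Unique⇒lookup-injective : ∀ {xs : List A} → Unique xs → ∀ {i j} →
      lookup xs i ≡ lookup xs j → i ≡ j
    Unique⇒lookup-injective {x ∷ xs} _ {zero} {zero} _ = refl
    Unique⇒lookup-injective {x ∷ xs} (x∉ ∷ _) {zero} {suc j} eq =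
      ⊥-elim (All.lookup x∉ (∈-lookup {xs = xs} j) eq)
    Unique⇒lookup-injective {x ∷ xs} (x∉ ∷ _) {suc i} {zero} eq =
      ⊥-elim (All.lookup x∉ (∈-lookup {xs = xs} i) (sym eq))
    Unique⇒lookup-injective {x ∷ xs} (_ ∷ u) {suc i} {suc j} eq =
      cong suc (Unique⇒lookup-injective u eq)

    -- Singles out the parent, or a neighbour along the cycle, in a list of neighbours; uniqueness
    -- of the result tells that the remaining entries differ from it.
    pull-out : ∀ {x} {xs : List A} → Unique xs → x ∈ xs → ∃ λ ys → xs ↭ x ∷ ys × Unique (x ∷ ys)
    pull-out {xs = x ∷ xs} u (here refl) = xs , ↭-refl , u
    pull-out {x} {y ∷ xs} (y∉xs ∷ u) (there x∈xs) with pull-out u x∈xs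
    ... | ys , p , (x∉ys ∷ uys) with All-resp-↭ p y∉xs
    ... | y≢x ∷ y∉ys =
      y ∷ ys , ↭-trans (prep y p) (swap y x ↭-refl) , (≢-sym y≢x ∷ x∉ys) ∷ (y∉ys ∷ uys)

    map-constant : ∀ {B : Set} {f : A → B} {c} {xs} → (∀ {x} → x ∈ xs → f x ≡ c) →
      map f xs ≡ replicate (length xs) c
    map-constant {xs = []} _ = refl
    map-constant {f = f} {c} {x ∷ xs} eq with f x | eq (here refl)
    ... | _ | refl = cong (c ∷_) (map-constant (eq ∘ there))

  -- Simple paths

  data Path {A : Set} (R : Rel A 0ℓ) : A → A → List A → Set where
    end  : ∀ {v} → Path R v v (v ∷ [])
    step : ∀ {u v w xs} → R u w → Path R w v xs → Path R u v (u ∷ xs)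

  module _ {A : Set} {R : Rel A 0ℓ} where
    path-first : ∀ {u v x xs} → Path R u v (x ∷ xs) → u ≡ x
    path-first end        = refl
    path-first (step _ _) = refl

    path-last : ∀ {u v x xs} → Path R u v (x ∷ xs) → lookup (x ∷ xs) (Fin.fromℕ (length xs)) ≡ v
    path-last end = refl
    path-last (step {xs = _ ∷ _} _ p) = path-last p

    path-step : ∀ {u v x xs} → Path R u v (x ∷ xs) →
                ∀ i → R (lookup (x ∷ xs) (inject₁ i)) (lookup (x ∷ xs) (suc i))
    path-step (step {xs = _ ∷ _} r p) zero = subst (R _) (path-first p) r
    path-step (step {xs = _ ∷ _} r p) (suc i) = path-step p i

    path-suffix : ∀ {u w v xs} → u ∈ xs → Path R w v xs → Unique xs →
      ∃ λ ys → Path R u v ys × Unique ys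
    path-suffix (here refl) end        un       = _ , end , un
    path-suffix (here refl) (step r p) un       = _ , step r p , un
    path-suffix (there u∈)  (step r p) (_ ∷ un) = path-suffix u∈ p un

  -- Loop erasure: if the new first vertex already occurs on the path, only the suffix from that
  -- occurrence is kept.
  simple-path : ∀ {n} {R : Rel (Fin n) 0ℓ} {u v} → Star R u v → ∃ λ xs → Path R u v xs × Unique xs
  simple-path ε = _ , end , [] ∷ []
  simple-path {u = u} (r ◅ rs) with simple-path rs
  ... | xs , p , un with DecMembership._∈?_ Fin._≟_ u xs
  ... | yes u∈xs = path-suffix u∈xs p un
  ... | no  u∉xs = _ , step r p , All.¬Any⇒All¬ xs u∉xs ∷ un

  -- Cyclic order of indices, and cycles from closed paths

  toℕ-next : ∀ {r} (i : Fin (suc r)) → toℕ (next i) ≡ suc (toℕ i) % suc r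
  toℕ-next {r} i = Fin.toℕ-fromℕ< (m%n<n (suc (toℕ i)) (suc r))

  next-inject₁ : ∀ {r} (i : Fin r) → next (inject₁ i) ≡ suc i
  next-inject₁ {r} i = Fin.toℕ-injective (trans (toℕ-next (inject₁ i))
    (trans (cong (λ k → suc k % suc r) (Fin.toℕ-inject₁ i)) (m<n⇒m%n≡m (ℕ.s≤s (Fin.toℕ<n i)))))

  next-fromℕ : ∀ r → next (Fin.fromℕ r) ≡ zero
  next-fromℕ r = Fin.toℕ-injective (trans (toℕ-next (Fin.fromℕ r))
    (trans (cong (λ k → suc k % suc r) (Fin.toℕ-fromℕ r)) (n%n≡0 (suc r))))

  prev : ∀ {r} → Fin (suc r) → Fin (suc r)
  prev zero    = Fin.fromℕ _
  prev (suc i) = inject₁ i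

  next-prev : ∀ {r} (i : Fin (suc r)) → next (prev i) ≡ i
  next-prev zero    = next-fromℕ _
  next-prev (suc i) = next-inject₁ i

  prev-next : ∀ {r} (i : Fin (suc r)) → prev (next i) ≡ i
  prev-next i with view i
  ... | ‵fromℕ     = cong prev (next-fromℕ _)
  ... | ‵inject₁ j = cong prev (next-inject₁ j)

  -- At the ends the wraparound sets index 1 against the last, or 0 against the last but one, and
  -- these differ once there are three vertices; elsewhere the two indices differ by two.
  next≢prev : ∀ {m} (i : Fin (3 ℕ.+ m)) → next i ≢ prev i
  next≢prev {m} zero eq with trans (sym (next-inject₁ {2 ℕ.+ m} zero)) eq
  ... | ()
  next≢prev (suc i) eq with view i
  ... | ‵fromℕ with trans (sym (next-fromℕ _)) eq
  ...   | ()
  next≢prev (suc i) eq | ‵inject₁ j with trans (sym (next-inject₁ (suc j))) eq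
  ... | suc-j≡ = ℕ.<⇒≢ (ℕ.m<n⇒m<1+n (ℕ.≤-refl {suc (toℕ j)}))
    (trans (sym (trans (Fin.toℕ-inject₁ (inject₁ j)) (Fin.toℕ-inject₁ j))) (cong toℕ (sym suc-j≡)))

  module _ {n} {G : Graph n} where
    open Graph G using (_~_)

    -- Irreflexivity rules out the path without steps and `¬ R u v` the path with one step. So at
    -- least three vertices remain, and the edge between the endpoints closes them up to a cycle.
    close-path : ∀ {R : Rel (Fin n) 0ℓ} → (∀ {u v} → R u v → u ~ v) →
                 ∀ {u v xs} → Path R u v xs → Unique xs → u ~ v → ¬ R u v →
                 ∃ λ (C : Cycle G) → Cycle.Edge C v u
    close-path R⊆~ end _ u~u _ = ⊥-elim (Graph.irrefl G refl u~u)
    close-path R⊆~ (step r end) _ _ ¬r = ⊥-elim (¬r r)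
    close-path R⊆~ {u} {v} p@(step r (step {xs = z ∷ ws} r′ p′)) un u~v _ = C , Fin.fromℕ _ , inj₁
      (sym (path-last p′) , cong (lookup xs) (sym (next-fromℕ _)))
      where
      xs = _ ∷ _ ∷ z ∷ ws

      adjacent : ∀ i → lookup xs i ~ lookup xs (next i)
      adjacent i with view i
      ... | ‵fromℕ rewrite next-fromℕ (2 ℕ.+ length ws) | path-last p′ = Graph.sym G u~v
      ... | ‵inject₁ j rewrite next-inject₁ j = R⊆~ (path-step p j)

      C : Cycle G
      C = record
        { m         = length ws
        ; vertex    = lookup xs
        ; injective = Unique⇒lookup-injective un
        ; adjacent  = adjacent
        }

    walk-snoc : ∀ {u v w d} → Walk G u v d → v ~ w → Walk G u w (suc d)
    walk-snoc nil        v~w = cons v~w nil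
    walk-snoc (cons e p) v~w = cons e (walk-snoc p v~w)

  -- The index is the level of the vertex itself. The entries `0 ∷ 0` belong to its two neighbours
  -- along the cycle, `j` to its parent, and the replicated ones to its children.
  data NeighbourLevels (ls : List ℕ) : ℕ → Set where
    on-cycle  : ∀ m → ls ↭ 0 ∷ 0 ∷ replicate m 1 → NeighbourLevels ls 0
    off-cycle : ∀ {j} m → ls ↭ j ∷ replicate m (2 ℕ.+ j) → NeighbourLevels ls (suc j)

  neighbours : ∀ {n} → Graph n → Fin n → List (Fin n)
  neighbours G v = filter (Graph._~?_ G v) (allFin _)

  -- Levels, parents and the shape of neighbourhoods

  module Levels {n} {G : Graph n} (U : IsUnicyclic G) where
    open Graph G using (_~_; _~?_)
    open IsUnicyclic U
    open Cycle cycle using (Edge; edge?; edge-sym; injective; adjacent)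

    -- Walks to the cycle of exactly the given length: this is decidable by finite search, and
    -- minimising the length afterwards gives the distance.
    Near : ℕ → Fin n → Set
    Near zero    v = ∃ λ i → v ≡ vertex i
    Near (suc j) v = ∃ λ u → v ~ u × Near j u

    near? : ∀ j v → Dec (Near j v)
    near? zero    v = Fin.any? (λ i → v Fin.≟ vertex i)
    near? (suc j) v = Fin.any? (λ u → (v ~? u) ×-dec near? j u)

    near : ∀ v → ∃ λ j → Near j v
    near v = go (connected v (vertex zero))
      where
      go : ∀ {v} → Star _~_ v (vertex zero) → ∃ λ j → Near j v
      go ε = 0 , zero , refl
      go (e ◅ es) with go es
      ... | j , nr = suc j , _ , e , nr

    abstract
      nearest : ∀ v → ∃ λ j → Near j v × (∀ i → Near i v → j ℕ.≤ i)
      nearest v = least (λ j → Near j v) (λ j → near? j v) (proj₁ (near v)) (proj₂ (near v))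

    level : Fin n → ℕ
    level v = proj₁ (nearest v)

    level-near : ∀ v → Near (level v) v
    level-near v = proj₁ (proj₂ (nearest v))

    level-minimal : ∀ {v j} → Near j v → level v ℕ.≤ j
    level-minimal {v} = proj₂ (proj₂ (nearest v)) _

    -- The default at `zero` makes a cycle vertex its own parent, so that irreflexivity later
    -- excludes edges from a cycle vertex to its parent.
    predecessor : ∀ j v → Near j v → Fin n
    predecessor zero    v _       = v
    predecessor (suc j) v (u , _) = u

    parent : Fin n → Fin n
    parent v = predecessor (level v) v (level-near v)

    -- A shorter walk from the predecessor to the cycle would extend to one from `v` that
    -- contradicts minimality. The variable `j` replaces `level v`, on which one cannot match.
    predecessor-spec : ∀ j v (nr : Near j v) → (∀ {i} → Near i v → j ℕ.≤ i) → ∀ {k} → j ≡ suc k →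
      v ~ predecessor j v nr × level (predecessor j v nr) ≡ k
    predecessor-spec (suc k) v (u , v~u , nr) minimal refl = v~u ,
      ℕ.≤-antisym (level-minimal nr) (ℕ.s≤s⁻¹ (minimal (u , v~u , level-near u)))

    parent-spec : ∀ v {k} → level v ≡ suc k → v ~ parent v × level (parent v) ≡ k
    parent-spec v = predecessor-spec (level v) v (level-near v) level-minimal

    parent-on-cycle : ∀ {v} → level v ≡ 0 → parent v ≡ v
    parent-on-cycle {v} eq = go (level v) (level-near v) eq
      where
      go : ∀ j (nr : Near j v) → j ≡ 0 → predecessor j v nr ≡ v
      go zero nr refl = refl

    level-vertex : ∀ i → level (vertex i) ≡ 0
    level-vertex i = ℕ.n≤0⇒n≡0 (level-minimal (i , refl))

    level-0 : ∀ v → level v ≡ 0 → ∃ λ i → v ≡ vertex i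
    level-0 v eq = subst (λ j → Near j v) eq (level-near v)

    Edge⇒level-0 : ∀ {u v} → Edge u v → level u ≡ 0
    Edge⇒level-0 (i , inj₁ (refl , _)) = level-vertex i
    Edge⇒level-0 (i , inj₂ (_ , refl)) = level-vertex (next i)

    Link : Rel (Fin n) 0ℓ
    Link u v = Edge u v ⊎ (v ≡ parent u ⊎ u ≡ parent v)

    link? : ∀ u v → Dec (Link u v)
    link? u v = edge? u v ⊎-dec ((v Fin.≟ parent u) ⊎-dec (u Fin.≟ parent v))

    -- The spanning subgraph of cycle edges and parent edges; that it is all of `G` is the content
    -- of `all-edges`.
    Skeleton : Rel (Fin n) 0ℓ
    Skeleton u v = u ~ v × Link u v

    skeleton-sym : Symmetric Skeleton
    skeleton-sym (u~v , l) = Graph.sym G u~v , [ inj₁ ∘ edge-sym , [ inj₂ ∘ inj₂ , inj₂ ∘ inj₁ ]′ ]′ l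

    -- Parents lead from any vertex down to the cycle, and the cycle leads to its starting vertex.
    skeleton-connected : ∀ u v → Star Skeleton u v
    skeleton-connected u v = to-start u ◅◅ Star.reverse skeleton-sym (to-start v)
      where
      around : ∀ i → Star Skeleton (vertex zero) (vertex i)
      around = <-weakInduction _ ε λ i p → p ◅◅
        subst (λ k → Skeleton (vertex (inject₁ i)) (vertex k)) (next-inject₁ i)
          (adjacent (inject₁ i) , inj₁ (inject₁ i , inj₁ (refl , refl))) ◅ ε

      descend : ∀ j v → level v ≡ j → ∃ λ i → Star Skeleton v (vertex i)
      descend zero v eq with level-0 v eq
      ... | i , refl = i , ε
      descend (suc j) v eq with parent-spec v eq
      ... | v~p , lev-p with descend j (parent v) lev-p
      ...   | i , path = i , (v~p , inj₂ (inj₁ refl)) ◅ path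

      to-start : ∀ v → Star Skeleton v (vertex zero)
      to-start v with descend (level v) v refl
      ... | i , path = path ◅◅ Star.reverse skeleton-sym (around i)

    -- Any other edge would close a second cycle.
    all-edges : ∀ {u v} → u ~ v → Link u v
    all-edges {u} {v} u~v with link? u v
    ... | yes l = l
    ... | no ¬l with simple-path (skeleton-connected u v)
    ...   | xs , p , un with close-path {G = G} proj₁ p un u~v (¬l ∘ proj₂)
    ...     | C , e = inj₁ (edge-sym (Equivalence.to (unique C v u) e))

    neighbours-unique : ∀ v → Unique (neighbours G v)
    neighbours-unique v = filter⁺ (v ~?_) (allFin⁺ n)

    ∈-neighbours⁺ : ∀ {v w} → v ~ w → w ∈ neighbours G v
    ∈-neighbours⁺ {v} {w} = ∈-filter⁺ (v ~?_) (∈-allFin w)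

    ∈-neighbours⁻ : ∀ {v w} → w ∈ neighbours G v → v ~ w
    ∈-neighbours⁻ {v} w∈ = proj₂ (∈-filter⁻ (v ~?_) {xs = allFin n} w∈)

    child-level : ∀ {v w} → v ~ w → v ≡ parent w → level w ≡ suc (level v)
    child-level {v} {w} v~w v≡p = go (level w) refl
      where
      go : ∀ j → level w ≡ j → level w ≡ suc (level v)
      go zero    eq = ⊥-elim (Graph.irrefl G (trans v≡p (parent-on-cycle eq)) v~w)
      go (suc j) eq = trans eq (cong suc (sym (trans (cong level v≡p) (proj₂ (parent-spec w eq)))))

    off-cycle-neighbour : ∀ {v w k} → level v ≡ suc k → v ~ w → w ≢ parent v → level w ≡ 2 ℕ.+ k
    off-cycle-neighbour {v} {w} eq v~w w≢p with all-edges v~w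
    ... | inj₁ e with trans (sym (Edge⇒level-0 e)) eq
    ...   | ()
    off-cycle-neighbour eq v~w w≢p | inj₂ (inj₁ w≡p) = ⊥-elim (w≢p w≡p)
    off-cycle-neighbour eq v~w w≢p | inj₂ (inj₂ v≡p) = trans (child-level v~w v≡p) (cong suc eq)

    cycle-neighbour : ∀ i {w} → Edge (vertex i) w → w ≡ vertex (next i) ⊎ w ≡ vertex (prev i)
    cycle-neighbour i (j , inj₁ (vi≡vj , w≡)) =
      inj₁ (trans w≡ (cong (vertex ∘ next) (sym (injective vi≡vj))))
    cycle-neighbour i (j , inj₂ (w≡ , vi≡)) =
      inj₂ (trans w≡ (cong vertex (trans (sym (prev-next j)) (cong prev (sym (injective vi≡))))))

    on-cycle-neighbour : ∀ i {w} → vertex i ~ w → w ≢ vertex (next i) → w ≢ vertex (prev i) → level w ≡ 1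
    on-cycle-neighbour i v~w w≢next w≢prev with all-edges v~w
    ... | inj₁ e = ⊥-elim ([ w≢next , w≢prev ]′ (cycle-neighbour i e))
    ... | inj₂ (inj₁ w≡p) =
      ⊥-elim (Graph.irrefl G (sym (trans w≡p (parent-on-cycle (level-vertex i)))) v~w)
    ... | inj₂ (inj₂ v≡p) = trans (child-level v~w v≡p) (cong suc (level-vertex i))

    -- Once the parent, or both neighbours along the cycle, are moved to the front, `all-edges`
    -- leaves only children among the rest.
    neighbour-levels : ∀ v → NeighbourLevels (map level (neighbours G v)) (level v)
    neighbour-levels v = go (level v) refl
      where
      go : ∀ j → level v ≡ j → NeighbourLevels (map level (neighbours G v)) j
      go (suc k) eq with parent-spec v eq
      ... | v~p , lev-p with pull-out (neighbours-unique v) (∈-neighbours⁺ v~p)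
      ...   | ws , perm , (p∉ws ∷ _) = off-cycle (length ws)
        (subst (map level (neighbours G v) ↭_)
          (trans (cong (_∷ map level ws) lev-p) (cong (k ∷_) (map-constant others)))
          (map⁺ level perm))
        where
        others : ∀ {w} → w ∈ ws → level w ≡ 2 ℕ.+ k
        others w∈ = off-cycle-neighbour eq
          (∈-neighbours⁻ (∈-resp-↭ (↭-sym perm) (there w∈))) (≢-sym (All.lookup p∉ws w∈))
      go zero eq with level-0 v eq
      ... | i , refl with pull-out (neighbours-unique v) (∈-neighbours⁺ (adjacent i))
      ... | ys , perm , (p∉ys ∷ uys) with ∈-resp-↭ perm
            (∈-neighbours⁺ (subst (_~ vertex (prev i)) (cong vertex (next-prev i)) (Graph.sym G (adjacent (prev i)))))
      ... | here q≡p = ⊥-elim (next≢prev i (injective (sym q≡p)))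
      ... | there q∈ys with pull-out uys q∈ys
      ... | ws , perm′ , (q∉ws ∷ _) with All-resp-↭ perm′ p∉ys
      ... | _ ∷ p∉ws = on-cycle (length ws)
        (subst (map level (neighbours G v) ↭_)
          (trans (cong (_∷ level (vertex (prev i)) ∷ map level ws) (level-vertex (next i)))
            (cong (0 ∷_) (trans (cong (_∷ map level ws) (level-vertex (prev i)))
              (cong (0 ∷_) (map-constant others)))))
          (map⁺ level perm″))
        where
        perm″ : neighbours G v ↭ vertex (next i) ∷ vertex (prev i) ∷ ws
        perm″ = ↭-trans perm (prep _ perm′)

        others : ∀ {w} → w ∈ ws → level w ≡ 1
        others w∈ = on-cycle-neighbour i
          (∈-neighbours⁻ (∈-resp-↭ (↭-sym perm″) (there (there w∈))))
          (≢-sym (All.lookup p∉ws w∈)) (≢-sym (All.lookup q∉ws w∈))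

    -- Levels against the heights of the trees

    private
      T : Graph n
      T = removeCycleEdges G cycle

    -- The parent edge of a vertex off the cycle survives the removal of the cycle edges, as both
    -- ends of a cycle edge have level 0.
    walk-from-cycle : ∀ j v → level v ≡ j → ∃ λ i → Walk T (vertex i) v j
    walk-from-cycle zero v eq with level-0 v eq
    ... | i , refl = i , nil
    walk-from-cycle (suc j) v eq with parent-spec v eq
    ... | v~p , lev-p with walk-from-cycle j (parent v) lev-p
    ...   | i , walk = i , walk-snoc {G = T} walk (Graph.sym G v~p ,
      λ e → ℕ.0≢1+n (trans (sym (Edge⇒level-0 (edge-sym e))) eq))

    walk-near : ∀ {e d u v} → Near e u → Walk T u v d → Near (d ℕ.+ e) v
    walk-near nr nil = nr
    walk-near {e} {v = v} nr (cons {d = d} (u~w , _) walk) =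
      subst (λ k → Near k v) (ℕ.+-suc d e) (walk-near {suc e} (_ , Graph.sym G u~w , nr) walk)

    walk-length : ∀ {i v d} → Walk T (vertex i) v d → level v ℕ.≤ d
    walk-length {v = v} {d} walk = level-minimal
      (subst (λ k → Near k v) (ℕ.+-identityʳ d) (walk-near {0} (_ , refl) walk))

    -- By `walk-length` the walk along the parents is a shortest one in its tree, so the level is a
    -- distance there and the height bounds it. The 1 added to the heights makes the bound strict.
    level-bound : ∀ {k} → IsK U k → ∀ v → level v ℕ.< k
    level-bound {k} (h , heights , k≡) v with walk-from-cycle (level v) v refl
    ... | i , walk = subst (level v ℕ.<_) (sym (trans k≡ (ℕ.+-comm _ 1))) (ℕ.s≤s
      (ℕ.≤-trans (proj₂ (heights i) v (level v) (walk , λ _ → walk-length)) (≤-foldr-⊔ h i)))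

-- Complete ordered fields

module OrderedField {c ℓ₁ ℓ₂} (ℝ : CompleteOrderedField c ℓ₁ ℓ₂) where
  open CompleteOrderedField ℝ
  open CommutativeRing commutativeRing public
    using ( refl; sym; trans; reflexive; setoid; ring; semiring; +-cong; +-congˡ; +-congʳ; *-cong
          ; *-congˡ; *-congʳ; -‿cong; zeroʳ; +-identityˡ; +-identityʳ
          ; +-assoc; +-comm; *-comm; *-identityˡ; *-identityʳ; -‿inverseʳ )
  open IsStrictTotalOrder isStrictTotalOrder public
    using (compare; <-respˡ-≈; <-respʳ-≈)
    renaming (trans to <-trans; irrefl to <-irrefl)

  -- Integer coefficients for the ring solver

  private
    module RP = RingProperties ring
    module M = Mult semiring

    ⟦_⟧ : ℤ → Carrier
    ⟦ + n ⟧      = fromℕ n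
    ⟦ -[1+ n ] ⟧ = - fromℕ (suc n)

    open SetoidReasoning setoid

    neg-homo : ∀ i → ⟦ ℤ.- i ⟧ ≈ - ⟦ i ⟧
    neg-homo (+ zero)  = sym RP.-0#≈0#
    neg-homo (+ suc n) = refl
    neg-homo -[1+ n ]  = sym (RP.-‿involutive _)

    ⊖-homo : ∀ m n → ⟦ m ℤ.⊖ n ⟧ ≈ fromℕ m - fromℕ n
    ⊖-homo m zero = sym (trans (+-congˡ RP.-0#≈0#) (+-identityʳ _))
    ⊖-homo zero (suc n) = sym (+-identityˡ _)
    ⊖-homo (suc m) (suc n) = begin
      ⟦ suc m ℤ.⊖ suc n ⟧                        ≡⟨ ≡.cong ⟦_⟧ (ℤ.[1+m]⊖[1+n]≡m⊖n m n) ⟩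
      ⟦ m ℤ.⊖ n ⟧                                ≈⟨ ⊖-homo m n ⟩
      fromℕ m - fromℕ n                          ≈⟨ +-congʳ (+-identityˡ _) ⟨
      0# + fromℕ m - fromℕ n                     ≈⟨ +-congʳ (+-congʳ (-‿inverseʳ 1#)) ⟨
      1# - 1# + fromℕ m - fromℕ n                ≈⟨ +-congʳ (+-assoc _ _ _) ⟩
      1# + (- 1# + fromℕ m) - fromℕ n            ≈⟨ +-congʳ (+-congˡ (+-comm _ _)) ⟩
      1# + (fromℕ m - 1#) - fromℕ n              ≈⟨ +-congʳ (+-assoc _ _ _) ⟨
      1# + fromℕ m - 1# - fromℕ n                ≈⟨ +-assoc _ _ _ ⟩
      1# + fromℕ m + (- 1# - fromℕ n)            ≈⟨ +-congˡ (RP.-‿+-comm _ _) ⟩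
      fromℕ (suc m) - fromℕ (suc n)              ∎

    +-homo : ∀ i j → ⟦ i ℤ.+ j ⟧ ≈ ⟦ i ⟧ + ⟦ j ⟧
    +-homo (+ m)    (+ n)    = M.×-homo-+ 1# m n
    +-homo (+ m)    -[1+ n ] = ⊖-homo m (suc n)
    +-homo -[1+ m ] (+ n)    = trans (⊖-homo n (suc m)) (+-comm _ _)
    +-homo -[1+ m ] -[1+ n ] = begin
      - fromℕ (2 ℕ.+ (m ℕ.+ n))             ≡⟨ ≡.cong (λ k → - fromℕ (suc k)) (ℕ.+-suc m n) ⟨
      - fromℕ (suc m ℕ.+ suc n)             ≈⟨ -‿cong (M.×-homo-+ 1# (suc m) (suc n)) ⟩
      - (fromℕ (suc m) + fromℕ (suc n))     ≈⟨ RP.-‿+-comm _ _ ⟨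
      - fromℕ (suc m) - fromℕ (suc n)       ∎

    *-homo⁺ : ∀ m j → ⟦ + m ℤ.* j ⟧ ≈ fromℕ m * ⟦ j ⟧
    *-homo⁺ m (+ n) = begin
      ⟦ + m ℤ.* + n ⟧     ≡⟨ ≡.cong ⟦_⟧ (ℤ.pos-* m n) ⟨
      fromℕ (m ℕ.* n)     ≈⟨ M.×1-homo-* m n ⟩
      fromℕ m * fromℕ n   ∎
    *-homo⁺ m -[1+ n ] = begin
      ⟦ + m ℤ.* -[1+ n ] ⟧          ≡⟨ ≡.cong ⟦_⟧ (ℤ.neg-distribʳ-* (+ m) (+ suc n)) ⟨
      ⟦ ℤ.- (+ m ℤ.* + suc n) ⟧     ≈⟨ neg-homo (+ m ℤ.* + suc n) ⟩
      - ⟦ + m ℤ.* + suc n ⟧         ≈⟨ -‿cong (*-homo⁺ m (+ suc n)) ⟩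
      - (fromℕ m * fromℕ (suc n))   ≈⟨ RP.-‿distribʳ-* _ _ ⟩
      fromℕ m * - fromℕ (suc n)     ∎

    *-homo : ∀ i j → ⟦ i ℤ.* j ⟧ ≈ ⟦ i ⟧ * ⟦ j ⟧
    *-homo (+ m) j = *-homo⁺ m j
    *-homo -[1+ m ] j = begin
      ⟦ -[1+ m ] ℤ.* j ⟧            ≡⟨ ≡.cong ⟦_⟧ (ℤ.neg-distribˡ-* (+ suc m) j) ⟨
      ⟦ ℤ.- (+ suc m ℤ.* j) ⟧       ≈⟨ neg-homo (+ suc m ℤ.* j) ⟩
      - ⟦ + suc m ℤ.* j ⟧           ≈⟨ -‿cong (*-homo⁺ (suc m) j) ⟩
      - (fromℕ (suc m) * ⟦ j ⟧)     ≈⟨ RP.-‿distribˡ-* _ _ ⟩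
      - fromℕ (suc m) * ⟦ j ⟧       ∎

    -- Unlike ⟦_⟧, sends + 1 to 1# itself and not to 1# + 0#, so that the
    -- solver's constants agree syntactically with both 1# and fromℕ n.
    ⟦_⟧₁ : ℤ → Carrier
    ⟦ + 1 ⟧₁ = 1#
    ⟦ i   ⟧₁ = ⟦ i ⟧

    ⟦⟧₁≈⟦⟧ : ∀ i → ⟦ i ⟧₁ ≈ ⟦ i ⟧
    ⟦⟧₁≈⟦⟧ (+ 0)           = refl
    ⟦⟧₁≈⟦⟧ (+ 1)           = sym (+-identityʳ 1#)
    ⟦⟧₁≈⟦⟧ (+ suc (suc n)) = refl
    ⟦⟧₁≈⟦⟧ -[1+ n ]        = refl

    morphism : ℤ.+-*-rawRing -Raw-AlmostCommutative⟶ fromCommutativeRing commutativeRing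
    morphism = record
      { ⟦_⟧    = ⟦_⟧₁
      ; +-homo = λ i j → trans (⟦⟧₁≈⟦⟧ (i ℤ.+ j))
          (trans (+-homo i j) (sym (+-cong (⟦⟧₁≈⟦⟧ i) (⟦⟧₁≈⟦⟧ j))))
      ; *-homo = λ i j → trans (⟦⟧₁≈⟦⟧ (i ℤ.* j))
          (trans (*-homo i j) (sym (*-cong (⟦⟧₁≈⟦⟧ i) (⟦⟧₁≈⟦⟧ j))))
      ; -‿homo = λ i → trans (⟦⟧₁≈⟦⟧ (ℤ.- i)) (trans (neg-homo i) (sym (-‿cong (⟦⟧₁≈⟦⟧ i))))
      ; 0-homo = refl
      ; 1-homo = refl
      }

    coeff≟ : ∀ i j → Maybe (⟦ i ⟧₁ ≈ ⟦ j ⟧₁)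
    coeff≟ i j with i ℤ.≟ j
    ... | yes i≡j = just (reflexive (≡.cong ⟦_⟧₁ i≡j))
    ... | no  _   = nothing

  open Algebra.Solver.Ring ℤ.+-*-rawRing (fromCommutativeRing commutativeRing) morphism coeff≟ public
    using (solve; _:=_; con; _:+_; _:*_; _:-_; :-_; Polynomial)

  :# : ∀ {n} → ℕ → Polynomial n
  :# k = con (+ k)


  -- The form in which most strict inequalities are proved: a visibly positive difference, with an
  -- identity left to the ring solver.
  <-cert : ∀ {x y d} → 0# < d → y ≈ x + d → x < y
  <-cert {x} 0<d y≈x+d = <-respʳ-≈ (sym (trans y≈x+d (+-comm _ _)))
    (<-respˡ-≈ (+-identityˡ x) (+-monoˡ-< x 0<d))

  <⇒0<- : ∀ {x y} → x < y → 0# < y - x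
  <⇒0<- {x} x<y = <-respˡ-≈ (-‿inverseʳ x) (+-monoˡ-< (- x) x<y)

  0≤- : ∀ {x y} → x ≤ y → 0# ≤ y - x
  0≤- (inj₁ p) = inj₁ (<⇒0<- p)
  0≤- {x} (inj₂ e) = inj₂ (sym (trans (+-congʳ (sym e)) (-‿inverseʳ x)))

  0<-⇒< : ∀ {x y} → 0# < y - x → x < y
  0<-⇒< {x} {y} p = <-cert p (solve 2 (λ x y → y := x :+ (y :- x)) refl x y)

  0<-by : ∀ {x y} → 0# < x → y ≈ x → 0# < y
  0<-by p e = <-respʳ-≈ (sym e) p

  +-pos : ∀ {x y} → 0# < x → 0# < y → 0# < x + y
  +-pos {x} {y} p q = <-trans q (<-cert p (+-comm x y))

  +-pos-≤ : ∀ {x y} → 0# < x → 0# ≤ y → 0# < x + y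
  +-pos-≤ p (inj₁ q) = +-pos p q
  +-pos-≤ p (inj₂ q) = 0<-by p (trans (+-congˡ (sym q)) (+-identityʳ _))

  <-irr : ∀ {x} → ¬ x < x
  <-irr = <-irrefl refl

  ≤⇒≯ : ∀ {x y} → x ≤ y → ¬ y < x
  ≤⇒≯ (inj₁ p) q = <-irr (<-trans p q)
  ≤⇒≯ (inj₂ p) q = <-irrefl (sym p) q

  ≰⇒> : ∀ {x y} → ¬ y ≤ x → x < y
  ≰⇒> {x} {y} y≰x with compare x y
  ... | tri< p _ _ = p
  ... | tri≈ _ e _ = ⊥-elim (y≰x (inj₂ (sym e)))
  ... | tri> _ _ p = ⊥-elim (y≰x (inj₁ p))

  ≤-refl : ∀ {x} → x ≤ x
  ≤-refl = inj₂ refl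

  ≤-<-trans : ∀ {x y z} → x ≤ y → y < z → x < z
  ≤-<-trans (inj₁ p) q = <-trans p q
  ≤-<-trans (inj₂ e) q = <-respˡ-≈ (sym e) q

  ≤-trans : ∀ {x y z} → x ≤ y → y ≤ z → x ≤ z
  ≤-trans p (inj₁ q) = inj₁ (≤-<-trans p q)
  ≤-trans (inj₁ p) (inj₂ e) = inj₁ (<-respʳ-≈ e p)
  ≤-trans (inj₂ d) (inj₂ e) = inj₂ (trans d e)

  +-mono-≤ : ∀ {x y u v} → x ≤ y → u ≤ v → x + u ≤ y + v
  +-mono-≤ {x} {y} {u} {v} p q = ≤-trans (left u p)
    (≤-trans (inj₂ (+-comm y u)) (≤-trans (left y q) (inj₂ (+-comm v y))))
    where
    left : ∀ {x y} z → x ≤ y → x + z ≤ y + z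
    left z (inj₁ p) = inj₁ (+-monoˡ-< z p)
    left z (inj₂ e) = inj₂ (+-congʳ e)

  *-nonneg : ∀ {x y} → 0# ≤ x → 0# ≤ y → 0# ≤ x * y
  *-nonneg (inj₁ p) (inj₁ q) = inj₁ (*-pos p q)
  *-nonneg {x} _ (inj₂ e) = inj₂ (sym (trans (*-congˡ (sym e)) (zeroʳ x)))
  *-nonneg {x} {y} (inj₂ e) _ =
    inj₂ (sym (trans (*-congʳ (sym e)) (trans (*-comm _ _) (zeroʳ y))))

  *-monoˡ-≤ : ∀ {x y} z → 0# ≤ z → x ≤ y → z * x ≤ z * y
  *-monoˡ-≤ {x} {y} z 0≤z (inj₂ e) = inj₂ (*-congˡ e)
  *-monoˡ-≤ {x} {y} z 0≤z (inj₁ p) with *-nonneg 0≤z (inj₁ (<⇒0<- p))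
  ... | inj₁ q = inj₁ (0<-⇒< (0<-by q
          (solve 3 (λ x y z → z :* y :- z :* x := z :* (y :- x)) refl x y z)))
  ... | inj₂ e = inj₂ (trans (sym (+-identityʳ _)) (trans (+-congˡ e)
          (solve 3 (λ x y z → z :* x :+ z :* (y :- x) := z :* y) refl x y z)))

  *-monoˡ-< : ∀ {x y} z → 0# < z → x < y → z * x < z * y
  *-monoˡ-< {x} {y} z 0<z p = 0<-⇒< (0<-by (*-pos 0<z (<⇒0<- p))
    (solve 3 (λ x y z → z :* y :- z :* x := z :* (y :- x)) refl x y z))

  *-cancelˡ-< : ∀ {x y} z → 0# ≤ z → z * x < z * y → x < y
  *-cancelˡ-< {x} {y} z 0≤z p with compare x y
  ... | tri< q _ _ = q
  ... | tri≈ _ e _ = ⊥-elim (<-irrefl (*-congˡ e) p)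
  ... | tri> _ _ q = ⊥-elim (≤⇒≯ (*-monoˡ-≤ z 0≤z (inj₁ q)) p)

  0<⇒≉0 : ∀ {x} → 0# < x → ¬ x ≈ 0#
  0<⇒≉0 p e = <-irrefl (sym e) p

  0<2 : 0# < fromℕ 2
  0<2 = +-pos 0<1 (0<-by 0<1 (+-identityʳ 1#))

  neg-pos : ∀ {x} → x < 0# → 0# < - x
  neg-pos {x} p = 0<-by (<⇒0<- p) (solve 1 (λ x → :- x := :# 0 :- x) refl x)

  ⁻¹-pos : ∀ {x} → 0# < x → 0# < x ⁻¹
  ⁻¹-pos {x} 0<x = *-cancelˡ-< x (inj₁ 0<x)
    (<-respˡ-≈ (sym (zeroʳ x)) (<-respʳ-≈ (sym (*-inverseʳ x (0<⇒≉0 0<x))) 0<1))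

  *-zero-cancelˡ : ∀ {x y} → ¬ x ≈ 0# → x * y ≈ 0# → y ≈ 0#
  *-zero-cancelˡ {x} {y} x≉0 e = begin
    y               ≈⟨ *-identityˡ y ⟨
    1# * y          ≈⟨ *-congʳ (*-inverseʳ x x≉0) ⟨
    x * x ⁻¹ * y    ≈⟨ solve 3 (λ x y z → x :* z :* y := z :* (x :* y)) refl x y (x ⁻¹) ⟩
    x ⁻¹ * (x * y)  ≈⟨ *-congˡ e ⟩
    x ⁻¹ * 0#       ≈⟨ zeroʳ _ ⟩
    0#              ∎

  -- Squares, square roots and roots of quadratics

  square-nonneg : ∀ x → 0# ≤ x * x
  square-nonneg x with compare x 0#
  ... | tri> _ _ p = inj₁ (*-pos p p)
  ... | tri≈ _ e _ = inj₂ (sym (trans (*-congˡ e) (zeroʳ x)))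
  ... | tri< p _ _ = inj₁ (0<-by (*-pos (neg-pos p) (neg-pos p))
                     (solve 1 (λ x → x :* x := (:- x) :* (:- x)) refl x))

  square-cancel-< : ∀ {x y} → 0# ≤ y → x * x < y * y → x < y
  square-cancel-< {x} {y} 0≤y p with compare x y
  ... | tri< q _ _ = q
  ... | tri≈ _ e _ = ⊥-elim (<-irrefl (*-cong e e) p)
  ... | tri> _ _ q = ⊥-elim (<-irr (<-trans p
    (<-cert (+-pos-≤ (*-pos (<⇒0<- q) (<⇒0<- q)) (*-nonneg (inj₁ 0<2) (*-nonneg 0≤y (inj₁ (<⇒0<- q)))))
      (solve 2 (λ x y → x :* x := y :* y :+ ((x :- y) :* (x :- y) :+ :# 2 :* (y :* (x :- y)))) refl x y))))

  between : ∀ {x y} → x < y → ∃ λ z → x < z × z < y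
  between {x} {y} p = x + h * d , <-cert pos refl
    , <-cert pos (trans (solve 2 (λ x y → y := x :+ :# 1 :* (y :- x)) refl x y)
        (trans (+-congˡ (*-congʳ (sym (*-inverseʳ (fromℕ 2) (0<⇒≉0 0<2)))))
        (solve 3 (λ x d h → x :+ :# 2 :* h :* d := x :+ h :* d :+ h :* d) refl x d h)))
    where
    d = y - x
    h = fromℕ 2 ⁻¹
    pos : 0# < h * d
    pos = *-pos (⁻¹-pos 0<2) (<⇒0<- p)

  -- The root is the supremum of all x with x² < D. If its square missed `D`, a small shift would
  -- give a larger member of the set or a smaller upper bound.
  sqrt : ∀ D → 0# < D → ∃ λ d → 0# ≤ d × d * d ≈ D
  sqrt D 0<D = d , 0≤d , d²≈D
    where
    P : Carrier → Set (c ⊔ ℓ₁ ⊔ ℓ₂)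
    P x = Lift (c ⊔ ℓ₁) (x * x < D)

    P-0 : P 0#
    P-0 = lift (<-respˡ-≈ (sym (zeroʳ 0#)) 0<D)

    bounded : ∀ b → 0# ≤ b → D ≤ b * b → IsUpperBound P b
    bounded b 0≤b D≤b² x (lift x²<D) =
      inj₁ (square-cancel-< 0≤b ([ <-trans x²<D , (λ e → <-respʳ-≈ e x²<D) ]′ D≤b²))

    sup : ∃ (IsSupremum P)
    sup = complete P (0# , P-0) (D + 1# , bounded (D + 1#) (inj₁ (+-pos 0<D 0<1))
      (inj₁ (<-cert (+-pos-≤ (+-pos 0<D 0<1) (square-nonneg D))
        (solve 1 (λ D → (D :+ :# 1) :* (D :+ :# 1) := D :+ (D :+ :# 1 :+ D :* D)) refl D))))

    d = proj₁ sup

    upper : IsUpperBound P d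
    upper = proj₁ (proj₂ sup)

    least : ∀ b → IsUpperBound P b → d ≤ b
    least = proj₂ (proj₂ sup)

    0≤d : 0# ≤ d
    0≤d = upper 0# P-0

    d²≮D : ¬ d * d < D
    d²≮D p = ≤⇒≯ (upper (d + e) (lift (<-cert (*-pos 0<e gap) expand))) (<-cert 0<e refl)
      where
      -- With e K = D - d² the difference D - (d + e)² equals e (1 + D - e), and D - e = d² + (D +
      -- 2d) e by the same equation.
      K = D + (fromℕ 2 * d + 1#)

      0≤2d : 0# ≤ fromℕ 2 * d
      0≤2d = *-nonneg (inj₁ 0<2) 0≤d

      0<K : 0# < K
      0<K = +-pos 0<D (0<-by (+-pos-≤ 0<1 0≤2d) (+-comm _ _))

      e = (D - d * d) * K ⁻¹

      0<e : 0# < e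
      0<e = *-pos (<⇒0<- p) (⁻¹-pos 0<K)

      eK : e * K ≈ D - d * d
      eK = trans (solve 3 (λ x k i → x :* i :* k := x :* (k :* i)) refl _ K (K ⁻¹))
        (trans (*-congˡ (*-inverseʳ K (0<⇒≉0 0<K))) (*-identityʳ _))

      gap : 0# < 1# + (d * d + (D + fromℕ 2 * d) * e)
      gap = +-pos-≤ 0<1 (≤-trans (inj₂ (sym (+-identityˡ 0#))) (+-mono-≤ (square-nonneg d)
        (*-nonneg (inj₁ (+-pos-≤ 0<D 0≤2d)) (inj₁ 0<e))))

      K′ : ∀ {n} → Polynomial n → Polynomial n → Polynomial n
      K′ D d = D :+ (:# 2 :* d :+ :# 1)

      expand : D ≈ (d + e) * (d + e) + e * (1# + (d * d + (D + fromℕ 2 * d) * e))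
      expand = sym (trans
        (solve 3 (λ D d e →
            (d :+ e) :* (d :+ e) :+ e :* (:# 1 :+ (d :* d :+ (D :+ :# 2 :* d) :* e))
          := d :* d :+ e :* K′ D d :+ e :* (d :* d :+ e :* K′ D d) :- e :* D)
          refl D d e)
        (trans (+-congʳ (+-cong (+-congˡ eK) (*-congˡ (+-congˡ eK))))
        (solve 3 (λ D d e →
            d :* d :+ (D :- d :* d) :+ e :* (d :* d :+ (D :- d :* d)) :- e :* D := D)
          refl D d e)))

    d²≯D : ¬ D < d * d
    d²≯D p = ≤⇒≯ (least (d - e) (bounded (d - e) (inj₁ 0<d-e) (inj₁ (<-cert (*-pos 0<e 0<e) expand))))
      (<-cert 0<e (solve 2 (λ d e → d := d :- e :+ e) refl d e))
      where
      0<d : 0# < d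
      0<d with 0≤d
      ... | inj₁ q = q
      ... | inj₂ q = ⊥-elim (<-irr (<-trans 0<D (<-respʳ-≈ (trans (*-congˡ (sym q)) (zeroʳ d)) p)))

      -- A Newton step: (d - e)² = D + e², so d - e is still an upper bound.
      K = fromℕ 2 * d

      0<K : 0# < K
      0<K = *-pos 0<2 0<d

      e = (d * d - D) * K ⁻¹

      0<e : 0# < e
      0<e = *-pos (<⇒0<- p) (⁻¹-pos 0<K)

      Ke : K * e ≈ d * d - D
      Ke = trans (solve 3 (λ x k i → k :* (x :* i) := x :* (k :* i)) refl _ K (K ⁻¹))
        (trans (*-congˡ (*-inverseʳ K (0<⇒≉0 0<K))) (*-identityʳ _))

      0<d-e : 0# < d - e
      0<d-e = *-cancelˡ-< K (inj₁ 0<K) (<-respˡ-≈ (sym (zeroʳ K))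
        (0<-by (+-pos (*-pos 0<d 0<d) 0<D)
          (trans (solve 2 (λ d e → :# 2 :* d :* (d :- e) := :# 2 :* (d :* d) :- :# 2 :* d :* e) refl d e)
          (trans (+-congˡ (-‿cong Ke))
          (solve 2 (λ D d → :# 2 :* (d :* d) :- (d :* d :- D) := d :* d :+ D) refl D d)))))

      expand : (d - e) * (d - e) ≈ D + e * e
      expand = trans
        (solve 2 (λ d e → (d :- e) :* (d :- e) := d :* d :- :# 2 :* d :* e :+ e :* e) refl d e)
        (trans (+-congʳ (+-congˡ (-‿cong Ke)))
        (solve 3 (λ D d e → d :* d :- (d :* d :- D) :+ e :* e := D :+ e :* e) refl D d e))

    d²≈D : d * d ≈ D
    d²≈D with compare (d * d) D
    ... | tri< p _ _ = ⊥-elim (d²≮D p)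
    ... | tri≈ _ e _ = e
    ... | tri> _ _ p = ⊥-elim (d²≯D p)

  -- The discriminant is (2b + B)² minus four times the negative value at `b`. Its square root
  -- therefore exceeds 2b + B, which puts the larger root above `b`.
  larger-root : ∀ B C b → b * b + B * b + C < 0# →
                ∃ λ x → b < x × x * x + B * x + C ≈ 0#
  larger-root B C b qb<0 = x , b<x , qx≈0
    where
    u = fromℕ 2 * b + B
    D = B * B - fromℕ 4 * C

    0<4 : 0# < fromℕ 4
    0<4 = 0<-by (+-pos 0<2 0<2) (solve 0 (:# 4 := :# 2 :+ :# 2) refl)

    u²<D : u * u < D
    u²<D = <-cert (*-pos 0<4 (neg-pos qb<0))
      (solve 3 (λ B C b → B :* B :- :# 4 :* C
          := (:# 2 :* b :+ B) :* (:# 2 :* b :+ B) :+ :# 4 :* (:- (b :* b :+ B :* b :+ C)))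
        refl B C b)

    root : ∃ λ d → 0# ≤ d × d * d ≈ D
    root = sqrt D (≤-<-trans (square-nonneg u) u²<D)

    d = proj₁ root
    h = fromℕ 2 ⁻¹
    x = (d - B) * h

    2x : fromℕ 2 * x ≈ d - B
    2x = trans (solve 3 (λ t y h → t :* (y :* h) := y :* (t :* h)) refl (fromℕ 2) (d - B) h)
      (trans (*-congˡ (*-inverseʳ (fromℕ 2) (0<⇒≉0 0<2))) (*-identityʳ _))

    b<x : b < x
    b<x = *-cancelˡ-< (fromℕ 2) (inj₁ 0<2) (0<-⇒< (0<-by
      (<⇒0<- (square-cancel-< (proj₁ (proj₂ root)) (<-respʳ-≈ (sym (proj₂ (proj₂ root))) u²<D)))
      (trans (+-congʳ 2x)
        (solve 3 (λ B b d → d :- B :- :# 2 :* b := d :- (:# 2 :* b :+ B)) refl B b d))))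

    qx≈0 : x * x + B * x + C ≈ 0#
    qx≈0 = *-zero-cancelˡ (0<⇒≉0 0<4) (trans
      (solve 3 (λ B C x → :# 4 :* (x :* x :+ B :* x :+ C)
        := :# 2 :* x :* (:# 2 :* x) :+ :# 2 :* B :* (:# 2 :* x) :+ :# 4 :* C) refl B C x)
      (trans (+-congʳ (+-cong (*-cong 2x 2x) (*-congˡ 2x)))
      (trans (solve 3 (λ B C d → (d :- B) :* (d :- B) :+ :# 2 :* B :* (d :- B) :+ :# 4 :* C
                := d :* d :- (B :* B :- :# 4 :* C)) refl B C d)
      (trans (+-congʳ (proj₂ (proj₂ root))) (-‿inverseʳ _)))))

  infix 25 _⊛_
  infixl 20 _⊞_

  -- Together with `_⊞_` this serves proofs by linear combination: the solver writes the goal as a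
  -- combination of expressions known to vanish.
  _⊛_ : ∀ {x} k → x ≈ 0# → k * x ≈ 0#
  k ⊛ e = trans (*-congˡ e) (zeroʳ k)

  _⊞_ : ∀ {x y} → x ≈ 0# → y ≈ 0# → x + y ≈ 0#
  e ⊞ f = trans (+-cong e f) (+-identityˡ 0#)

  ≈⇒-≈0 : ∀ {x y} → x ≈ y → y - x ≈ 0#
  ≈⇒-≈0 {x} e = trans (+-congʳ (sym e)) (-‿inverseʳ x)

  -≈0⇒≈ : ∀ {x y} → y - x ≈ 0# → x ≈ y
  -≈0⇒≈ {x} {y} e = sym (trans (solve 2 (λ x y → y := y :- x :+ x) refl x y)
    (trans (+-congʳ e) (+-identityˡ x)))

-- The matrices Z and W

module LevelWeights {c ℓ₁ ℓ₂} (ℝ : CompleteOrderedField c ℓ₁ ℓ₂) where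
  open CompleteOrderedField ℝ
  open OrderedField ℝ
  open Spectral ℝ

  -- Positive weights on the distances 0, …, N from the cycle, a strict
  -- supersolution of the extremal graph: the cycle vertices have one child each,
  -- the other vertices at distance below N have two.
  record Supersolution (t s : Carrier) (N : ℕ) : Set (c ⊔ ℓ₂) where
    field
      weight : ℕ → Carrier
      pos    : ∀ j → 0# < weight j
      root   : fromℕ 2 * weight 0 + weight 1 < t * weight 0
      inner  : ∀ j → suc j ℕ.< N →
               weight j + fromℕ 2 * weight (2 ℕ.+ j) < t * weight (suc j)
      -- A leaf has degree 1, so its diagonal term s stays 2s below the 3s on the right-hand side.
      leaf   : ∀ j → suc j ≡ N → weight j < (t + fromℕ 2 * s) * weight (suc j)

  -- For the vector (1, x - δ) the first row holds identically and the second is the characteristic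
  -- equation.
  W-eigenvalue : ∀ {δ x} → (x - δ) * (x - fromℕ 2) ≈ 1# → IsEigenvalue (W δ) x
  W-eigenvalue {δ} {x} e = (1# ∷ᵛ x - δ ∷ᵛ []ᵛ) , (zero , 0<⇒≉0 0<1) , λ where
    zero → solve 2 (λ δ x → δ :* :# 1 :+ (:# 1 :* (x :- δ) :+ :# 0) := x :* :# 1) refl δ x
    (suc zero) → -≈0⇒≈ (trans
      (solve 2 (λ δ x → x :* (x :- δ) :- (:# 1 :* :# 1 :+ (:# 2 :* (x :- δ) :+ :# 0))
        := (x :- δ) :* (x :- :# 2) :- :# 1) refl δ x)
      (≈⇒-≈0 (sym e)))

  -- Eliminating the first coordinate leaves the equation times the second one, which is nonzero:
  -- otherwise the second row would make the first coordinate vanish too.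
  W-characteristic : ∀ {δ t} → IsEigenvalue (W δ) t → (t - δ) * (t - fromℕ 2) ≈ 1#
  W-characteristic {δ} {t} (x , (i , xi≉0) , eig) = sym (-≈0⇒≈ (*-zero-cancelˡ b≉0 (trans
      (solve 4 (λ δ t a b → b :* ((t :- δ) :* (t :- :# 2) :- :# 1)
        := (t :- δ) :* (t :* b :- (:# 1 :* a :+ (:# 2 :* b :+ :# 0)))
           :+ :# 1 :* (t :* a :- (δ :* a :+ (:# 1 :* b :+ :# 0)))) refl δ t a b)
      ((t - δ) ⊛ e₁ ⊞ 1# ⊛ e₀))))
    where
    a = x zero
    b = x (suc zero)
    e₀ = ≈⇒-≈0 (eig zero)
    e₁ = ≈⇒-≈0 (eig (suc zero))

    b≉0 : ¬ b ≈ 0#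
    b≉0 b≈0 = xi≉0 (all i)
      where
      all : ∀ i → x i ≈ 0#
      all (suc zero) = b≈0
      all zero = trans
        (solve 3 (λ t a b → a := (t :- :# 2) :* b
          :+ (:- :# 1) :* (t :* b :- (:# 1 :* a :+ (:# 2 :* b :+ :# 0)))) refl t a b)
        ((t - fromℕ 2) ⊛ b≈0 ⊞ (- 1#) ⊛ e₁)

  -- The characteristic polynomial x² + B x + C has the value -1 at 2, so it has a root above 2.
  W-2<ρ : ∀ {δ t} → IsSpectralRadius (W δ) t → fromℕ 2 < t
  W-2<ρ {δ} {t} (_ , maximal) = bigger (larger-root B C (fromℕ 2) q<0)
    where
    B = - (δ + fromℕ 2)
    C = fromℕ 2 * δ - 1#

    q<0 : fromℕ 2 * fromℕ 2 + B * fromℕ 2 + C < 0#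
    q<0 = <-cert 0<1 (solve 1 (λ δ → :# 0 := :# 2 :* :# 2 :+ (:- (δ :+ :# 2)) :* :# 2
      :+ (:# 2 :* δ :- :# 1) :+ :# 1) refl δ)

    bigger : (∃ λ x → fromℕ 2 < x × x * x + B * x + C ≈ 0#) → fromℕ 2 < t
    bigger (x , 2<x , qx≈0) with maximal x (W-eigenvalue (sym (-≈0⇒≈ (trans
        (solve 2 (λ δ x → (x :- δ) :* (x :- :# 2) :- :# 1
          := x :* x :+ (:- (δ :+ :# 2)) :* x :+ (:# 2 :* δ :- :# 1)) refl δ x) qx≈0))))
    ... | inj₁ x<t = <-trans 2<x x<t
    ... | inj₂ x≈t = <-respʳ-≈ x≈t 2<x

  -- The vector solves rows three and two upwards from its last coordinate, scaled by √2 to avoid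
  -- division; the first row is then the characteristic equation.
  Z-eigenvalue : ∀ {√2 γ x} → 0# < √2 → √2 * √2 ≈ fromℕ 2 →
    (x - γ) * (x * x - fromℕ 2 * x - 1#) ≈ fromℕ 2 * (x - fromℕ 2) → IsEigenvalue (Z √2 γ) x
  Z-eigenvalue {r} {γ} {x} 0<r r² e =
    (x * x - fromℕ 2 * x - 1# ∷ᵛ r * (x - fromℕ 2) ∷ᵛ r ∷ᵛ []ᵛ) , (suc (suc zero) , 0<⇒≉0 0<r) , λ where
      zero → -≈0⇒≈ (trans
        (solve 3 (λ r γ x → x :* (x :* x :- :# 2 :* x :- :# 1)
            :- (γ :* (x :* x :- :# 2 :* x :- :# 1) :+ (r :* (r :* (x :- :# 2)) :+ (:# 0 :* r :+ :# 0)))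
          := :# 1 :* ((x :- γ) :* (x :* x :- :# 2 :* x :- :# 1) :- :# 2 :* (x :- :# 2))
            :+ (x :- :# 2) :* (:# 2 :- r :* r)) refl r γ x)
        (1# ⊛ ≈⇒-≈0 (sym e) ⊞ (x - fromℕ 2) ⊛ ≈⇒-≈0 r²))
      (suc zero) → solve 2 (λ r x → r :* (x :* x :- :# 2 :* x :- :# 1)
          :+ (:# 0 :* (r :* (x :- :# 2)) :+ (:# 1 :* r :+ :# 0)) := x :* (r :* (x :- :# 2))) refl r x
      (suc (suc zero)) → solve 3 (λ r q x → :# 0 :* q
          :+ (:# 1 :* (r :* (x :- :# 2)) :+ (:# 2 :* r :+ :# 0)) := x :* r)
          refl r (x * x - fromℕ 2 * x - 1#) x

  -- Eliminating the first two coordinates leaves the equation times the third one, which is nonzero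
  -- because rows three and two determine the others from it.
  Z-characteristic : ∀ {√2 γ t} → 0# < √2 → √2 * √2 ≈ fromℕ 2 → IsEigenvalue (Z √2 γ) t →
    (t - γ) * (t * t - fromℕ 2 * t - 1#) ≈ fromℕ 2 * (t - fromℕ 2)
  Z-characteristic {r} {γ} {t} 0<r r² (x , (i , xi≉0) , eig) = sym (-≈0⇒≈ (*-zero-cancelˡ d≉0 (trans
      (solve 6 (λ r γ t a b d →
          d :* ((t :- γ) :* (t :* t :- :# 2 :* t :- :# 1) :- :# 2 :* (t :- :# 2))
        := r :* E₀ r γ t a b d :+ (:- b) :* (:# 2 :- r :* r)
           :+ (t :- γ) :* E₁ r γ t a b d :+ ((t :- γ) :* t :- :# 2) :* E₂ r γ t a b d) refl r γ t a b d)
      (r ⊛ e₀ ⊞ (- b) ⊛ ≈⇒-≈0 r² ⊞ (t - γ) ⊛ e₁ ⊞ ((t - γ) * t - fromℕ 2) ⊛ e₂))))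
    where
    a = x zero
    b = x (suc zero)
    d = x (suc (suc zero))
    e₀ = ≈⇒-≈0 (eig zero)
    e₁ = ≈⇒-≈0 (eig (suc zero))
    e₂ = ≈⇒-≈0 (eig (suc (suc zero)))

    E₀ E₁ E₂ : ∀ {n} (r γ t a b d : Polynomial n) → Polynomial n
    E₀ r γ t a b d = t :* a :- (γ :* a :+ (r :* b :+ (:# 0 :* d :+ :# 0)))
    E₁ r γ t a b d = t :* b :- (r :* a :+ (:# 0 :* b :+ (:# 1 :* d :+ :# 0)))
    E₂ r γ t a b d = t :* d :- (:# 0 :* a :+ (:# 1 :* b :+ (:# 2 :* d :+ :# 0)))

    d≉0 : ¬ d ≈ 0#
    d≉0 d≈0 = xi≉0 (all i)
      where
      all : ∀ i → x i ≈ 0#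
      all (suc (suc zero)) = d≈0
      all (suc zero) = trans
        (solve 6 (λ r γ t a b d → b := (t :- :# 2) :* d :+ (:- :# 1) :* E₂ r γ t a b d) refl r γ t a b d)
        ((t - fromℕ 2) ⊛ d≈0 ⊞ (- 1#) ⊛ e₂)
      all zero = *-zero-cancelˡ (0<⇒≉0 0<r) (trans
        (solve 6 (λ r γ t a b d → r :* a := t :* b :+ (:- :# 1) :* d :+ (:- :# 1) :* E₁ r γ t a b d)
          refl r γ t a b d)
        (t ⊛ all (suc zero) ⊞ (- 1#) ⊛ d≈0 ⊞ (- 1#) ⊛ e₁))

  1<√2 : ∀ {√2} → 0# < √2 → √2 * √2 ≈ fromℕ 2 → 1# < √2
  1<√2 {r} 0<r r² = square-cancel-< (inj₁ 0<r) (<-respʳ-≈ (sym r²) (<-cert 0<1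
    (solve 0 (:# 2 := :# 1 :* :# 1 :+ :# 1) refl)))

  -- 1 + √2 is the spectral radius of the lower right 2 × 2 block of Z.
  Z-1+√2<ρ : ∀ {√2 γ t} → 0# < √2 → √2 * √2 ≈ fromℕ 2 → IsSpectralRadius (Z √2 γ) t → 1# + √2 < t
  Z-1+√2<ρ {r} {γ} {t} 0<r r² (eigenvalue , maximal) =
    ≰⇒> λ t≤b → exceeds t≤b (larger-root B C b (q<0 t≤b))
    where
    b = 1# + r
    -- The quotient of the characteristic polynomial `P` by x - t is `Q`, that is x² + B x + C.
    B = t - fromℕ 2 - γ
    C = t * t - (fromℕ 2 + γ) * t + fromℕ 2 * γ - fromℕ 3

    P : ∀ {n} (γ x : Polynomial n) → Polynomial n
    P γ x = (x :- γ) :* (x :* x :- :# 2 :* x :- :# 1) :- :# 2 :* (x :- :# 2)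

    Q : ∀ {n} (γ t x : Polynomial n) → Polynomial n
    Q γ t x = x :* x :+ (t :- :# 2 :- γ) :* x :+ (t :* t :- (:# 2 :+ γ) :* t :+ :# 2 :* γ :- :# 3)

    Pt≈0 : (t - γ) * (t * t - fromℕ 2 * t - 1#) - fromℕ 2 * (t - fromℕ 2) ≈ 0#
    Pt≈0 = ≈⇒-≈0 (sym (Z-characteristic 0<r r² eigenvalue))

    -- As b² - 2b - 1 = 0, the value P(b) = (b - t) Q(b) is -2 (√2 - 1) < 0. Hence Q(b) < 0, and `Q`
    -- has a root above b, an eigenvalue larger than t.
    q<0 : t ≤ b → b * b + B * b + C < 0#
    q<0 t≤b = ≰⇒> λ 0≤q → ≤⇒≯ (*-nonneg (0≤- t≤b) 0≤q)
      (<-cert (*-pos 0<2 (<⇒0<- (1<√2 0<r r²))) (sym (trans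
        (solve 3 (λ γ t r →
            ((:# 1 :+ r) :- t) :* Q γ t (:# 1 :+ r) :+ :# 2 :* (r :- :# 1)
          := (:- :# 1) :* P γ t :+ (:- (:# 1 :+ r :- γ)) :* (:# 2 :- r :* r)) refl γ t r)
        ((- 1#) ⊛ Pt≈0 ⊞ (- (b - γ)) ⊛ ≈⇒-≈0 r²))))

    exceeds : t ≤ b → (∃ λ x → b < x × x * x + B * x + C ≈ 0#) → ⊥
    exceeds t≤b (x , b<x , q≈0) = ≤⇒≯ (maximal x (Z-eigenvalue 0<r r² (sym (-≈0⇒≈ (trans
        (solve 3 (λ γ t x → P γ x := :# 1 :* P γ t :+ (x :- t) :* Q γ t x) refl γ t x)
        (1# ⊛ Pt≈0 ⊞ (x - t) ⊛ q≈0)))))) (≤-<-trans t≤b b<x)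

  -- Strict supersolutions from the spectral radii

  between-scaled : ∀ {a e c} → 0# < e → a < e * c → ∃ λ y → a < e * y × y < c
  between-scaled {a} {e} {c} 0<e a<ec =
    y , <-respˡ-≈ e*a/e (*-monoˡ-< e 0<e (proj₁ (proj₂ mid))) , proj₂ (proj₂ mid)
    where
    e*a/e : e * (a / e) ≈ a
    e*a/e = trans (solve 3 (λ e a i → e :* (a :* i) := a :* (e :* i)) refl e a (e ⁻¹))
      (trans (*-congˡ (*-inverseʳ e (0<⇒≉0 0<e))) (*-identityʳ a))

    mid = between (*-cancelˡ-< e (inj₁ 0<e) (<-respˡ-≈ (sym e*a/e) a<ec))
    y = proj₁ mid

  -- The inequalities to be solved are 1 < (t - 2) w₀ and w₀ < t + 2s, and
  -- t - δ is the value of w₀ turning the first one into an equality.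
  W-supersolution : ∀ {δ t s} → IsSpectralRadius (W δ) t → - (fromℕ 2 * s) < δ →
                    Supersolution t s 1
  W-supersolution {δ} {t} {s} ρ[W] -2s<δ = record
    { weight = weight
    ; pos    = λ { zero → pos₀ ; (suc j) → 0<1 }
    ; root   = 0<-⇒< (0<-by (<⇒0<- 1<e*w₀)
        (solve 2 (λ t w → t :* w :- (:# 2 :* w :+ :# 1) := (t :- :# 2) :* w :- :# 1) refl t w₀))
    ; inner  = λ { j (ℕ.s≤s ()) }
    ; leaf   = λ { zero ≡.refl → <-respʳ-≈ (sym (*-identityʳ _)) w₀<u }
    }
    where
    e = t - fromℕ 2
    0<e : 0# < e
    0<e = <⇒0<- (W-2<ρ ρ[W])

    -- Since (t - δ) (t - 2) = 1, replacing δ by the smaller -2s makes the product exceed 1.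
    1<e*u : 1# < e * (t + fromℕ 2 * s)
    1<e*u = <-cert (*-pos 0<e (<⇒0<- -2s<δ)) (-≈0⇒≈ (trans
      (solve 3 (λ δ t s →
          :# 1 :+ (t :- :# 2) :* (δ :- (:- (:# 2 :* s))) :- (t :- :# 2) :* (t :+ :# 2 :* s)
          := :# 1 :- (t :- δ) :* (t :- :# 2)) refl δ t s)
      (≈⇒-≈0 (W-characteristic (proj₁ ρ[W])))))

    w = between-scaled 0<e 1<e*u
    w₀ = proj₁ w
    1<e*w₀ = proj₁ (proj₂ w)
    w₀<u = proj₂ (proj₂ w)

    pos₀ : 0# < w₀
    pos₀ = *-cancelˡ-< e (inj₁ 0<e) (<-respˡ-≈ (sym (zeroʳ e)) (<-trans 0<1 1<e*w₀))

    weight : ℕ → Carrier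
    weight zero    = w₀
    weight (suc j) = 1#

  -- Given w₁, the inequalities w₁ < (t - 2) w₀ and w₀ + 2 < t w₁ have a common
  -- solution w₀ exactly when t - γ < w₁.
  Z-supersolution : ∀ {√2 γ t s} → 0# < √2 → √2 * √2 ≈ fromℕ 2 →
                    IsSpectralRadius (Z √2 γ) t → - (fromℕ 2 * s) < γ → Supersolution t s 2
  Z-supersolution {r} {γ} {t} {s} 0<r r² ρ[Z] -2s<γ = record
    { weight = weight
    ; pos    = λ { zero → pos₀ ; (suc zero) → pos₁ ; (suc (suc j)) → 0<1 }
    ; root   = 0<-⇒< (0<-by (<⇒0<- w₁<e*w₀)
        (solve 3 (λ t w v → t :* w :- (:# 2 :* w :+ v) := (t :- :# 2) :* w :- v) refl t w₀ w₁))
    ; inner  = λ { zero _ → 0<-⇒< (0<-by (<⇒0<- w₀<v)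
                     (solve 3 (λ t w v → t :* v :- (w :+ :# 2 :* :# 1) := t :* v :- :# 2 :- w) refl t w₀ w₁))
                 ; (suc j) (ℕ.s≤s (ℕ.s≤s ())) }
    ; leaf   = λ { (suc zero) ≡.refl → <-respʳ-≈ (sym (*-identityʳ _)) w₁<u }
    }
    where
    e = t - fromℕ 2
    q = t * t - fromℕ 2 * t - 1#

    b<t = Z-1+√2<ρ 0<r r² ρ[Z]

    0<e : 0# < e
    0<e = 0<-by (+-pos (<⇒0<- b<t) (<⇒0<- (1<√2 0<r r²)))
      (solve 2 (λ t r → t :- :# 2 := (t :- (:# 1 :+ r)) :+ (r :- :# 1)) refl t r)

    -- The roots of `q` as a polynomial in t are 1 + √2 and 1 - √2, both below t.
    0<q : 0# < q
    0<q = 0<-by (*-pos (<⇒0<- b<t) (+-pos (<⇒0<- b<t) (*-pos 0<2 0<r)))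
      (-≈0⇒≈ (trans (solve 2 (λ t r → (t :- (:# 1 :+ r)) :* ((t :- (:# 1 :+ r)) :+ :# 2 :* r)
            :- (t :* t :- :# 2 :* t :- :# 1) := :# 2 :- r :* r) refl t r)
        (≈⇒-≈0 r²)))

    w₁-bounds = between {t - γ} {t + fromℕ 2 * s} (0<-⇒< (0<-by (<⇒0<- -2s<γ)
      (solve 3 (λ t γ s → t :+ :# 2 :* s :- (t :- γ) := γ :- (:- (:# 2 :* s))) refl t γ s)))
    w₁ = proj₁ w₁-bounds
    t-γ<w₁ = proj₁ (proj₂ w₁-bounds)
    w₁<u = proj₂ (proj₂ w₁-bounds)

    -- What remains of the two inequalities after eliminating w₀; the characteristic equation is its
    -- equality case w₁ = t - γ.
    2e<q*w₁ : fromℕ 2 * e < q * w₁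
    2e<q*w₁ = <-respˡ-≈ (trans (*-comm _ _) (Z-characteristic 0<r r² (proj₁ ρ[Z])))
      (*-monoˡ-< q 0<q t-γ<w₁)

    pos₁ : 0# < w₁
    pos₁ = *-cancelˡ-< q (inj₁ 0<q) (<-respˡ-≈ (sym (zeroʳ q)) (<-trans (*-pos 0<2 0<e) 2e<q*w₁))

    w₀-bounds = between-scaled {w₁} {e} {t * w₁ - fromℕ 2} 0<e (0<-⇒< (0<-by (<⇒0<- 2e<q*w₁)
      (solve 2 (λ t w → (t :- :# 2) :* (t :* w :- :# 2) :- w
        := (t :* t :- :# 2 :* t :- :# 1) :* w :- :# 2 :* (t :- :# 2)) refl t w₁)))
    w₀ = proj₁ w₀-bounds
    w₁<e*w₀ = proj₁ (proj₂ w₀-bounds)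
    w₀<v = proj₂ (proj₂ w₀-bounds)

    pos₀ : 0# < w₀
    pos₀ = *-cancelˡ-< e (inj₁ 0<e) (<-respˡ-≈ (sym (zeroʳ e)) (<-trans pos₁ w₁<e*w₀))

    weight : ℕ → Carrier
    weight zero          = w₀
    weight (suc zero)    = w₁
    weight (suc (suc j)) = 1#

-- Eigenvalues of Aα

module WeightedRowSums {c ℓ₁ ℓ₂} (ℝ : CompleteOrderedField c ℓ₁ ℓ₂) where
  open UnicyclicGraphs
  open CompleteOrderedField ℝ
  open OrderedField ℝ
  open LevelWeights ℝ
  open Spectral ℝ
  open AαMatrix ℝ
  open SemiringSum semiring using (sum-cong-≋; ∑-distrib-+; *-distribˡ-sum)

  -- Comparison of eigenvalues with a positive vector

  argmax : ∀ {n} (f : Fin (suc n) → Carrier) → ∃ λ i → ∀ j → f j ≤ f i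
  argmax {zero}  f = zero , λ { zero → ≤-refl }
  argmax {suc n} f with argmax (λ j → f (suc j))
  ... | i , max with compare (f zero) (f (suc i))
  ... | tri< p _ _ = suc i , λ { zero → inj₁ p ; (suc j) → max j }
  ... | tri≈ _ e _ = suc i , λ { zero → inj₂ e ; (suc j) → max j }
  ... | tri> _ _ p = zero , λ { zero → ≤-refl ; (suc j) → ≤-trans (max j) (inj₁ p) }

  sum-mono-≤ : ∀ {n} {f g : Fin n → Carrier} → (∀ i → f i ≤ g i) → sum f ≤ sum g
  sum-mono-≤ {zero}  f≤g = ≤-refl
  sum-mono-≤ {suc n} f≤g = +-mono-≤ (f≤g zero) (sum-mono-≤ (λ i → f≤g (suc i)))

  -- Compare the eigenvector with the positive vector x at an index where
  -- their ratio is largest.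
  eigenvalue-bound-pos : ∀ {n} {M : Matrix n} {x y : Fin n → Carrier} {b μ} →
    (∀ i j → 0# ≤ M i j) → (∀ i → 0# < x i) → (∀ i → sum (λ j → M i j * x j) < b * x i) →
    (∀ i → sum (λ j → M i j * y j) ≈ μ * y i) → ∀ k → 0# < y k → μ < b
  eigenvalue-bound-pos {suc n} {M} {x} {y} {b} {μ} M≥0 x>0 Mx<bx My≈μy k yk>0 =
    *-cancelˡ-< (x i) (inj₁ (x>0 i)) (<-respˡ-≈ (*-comm _ _) (<-respʳ-≈ (*-comm _ _)
      (*-cancelˡ-< r (inj₁ r>0) (≤-<-trans rμx≤ (*-monoˡ-< r r>0 (Mx<bx i))))))
    where
    ratio : Fin (suc n) → Carrier
    ratio j = y j / x j

    i = proj₁ (argmax ratio)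
    r = ratio i

    y≈ratio*x : ∀ j → y j ≈ ratio j * x j
    y≈ratio*x j = sym (trans (solve 3 (λ x y i → y :* i :* x := y :* (x :* i)) refl (x j) (y j) (x j ⁻¹))
      (trans (*-congˡ (*-inverseʳ (x j) (0<⇒≉0 (x>0 j)))) (*-identityʳ _)))

    y≤r*x : ∀ j → y j ≤ r * x j
    y≤r*x j = ≤-trans (inj₂ (trans (y≈ratio*x j) (*-comm _ _)))
      (≤-trans (*-monoˡ-≤ (x j) (inj₁ (x>0 j)) (proj₂ (argmax ratio) j)) (inj₂ (*-comm _ _)))

    r>0 : 0# < r
    r>0 = [ <-trans 0<ratio-k , (λ e → <-respʳ-≈ e 0<ratio-k) ]′ (proj₂ (argmax ratio) k)
      where
      0<ratio-k : 0# < ratio k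
      0<ratio-k = *-pos yk>0 (⁻¹-pos (x>0 k))

    -- At the maximising index y equals r x, elsewhere y is at most r x, and the entries of `M` are
    -- nonnegative.
    rμx≤ : r * (μ * x i) ≤ r * sum (λ j → M i j * x j)
    rμx≤ = ≤-trans (inj₂ (trans (solve 3 (λ r μ x → r :* (μ :* x) := μ :* (r :* x)) refl r μ (x i))
        (trans (*-congˡ (sym (y≈ratio*x i))) (sym (My≈μy i)))))
      (≤-trans (sum-mono-≤ (λ j → *-monoˡ-≤ (M i j) (M≥0 i j) (y≤r*x j)))
      (inj₂ (trans (sum-cong-≋ (λ j →
          solve 3 (λ m r x → m :* (r :* x) := r :* (m :* x)) refl (M i j) r (x j)))
        (sym (*-distribˡ-sum r (λ j → M i j * x j))))))

  -- Replacing an eigenvector by its negative, if necessary, provides a positive entry.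
  eigenvalue-bound : ∀ {n} {M : Matrix n} {x : Fin n → Carrier} {b μ} →
    (∀ i j → 0# ≤ M i j) → (∀ i → 0# < x i) → (∀ i → sum (λ j → M i j * x j) < b * x i) →
    IsEigenvalue M μ → μ < b
  eigenvalue-bound {n} {M} {x} {b} {μ} M≥0 x>0 Mx<bx (y , (k , yk≉0) , My≈μy) with compare (y k) 0#
  ... | tri> _ _ yk>0 = eigenvalue-bound-pos M≥0 x>0 Mx<bx My≈μy k yk>0
  ... | tri≈ _ yk≈0 _ = ⊥-elim (yk≉0 yk≈0)
  ... | tri< yk<0 _ _ = eigenvalue-bound-pos M≥0 x>0 Mx<bx -My≈-μy k (neg-pos yk<0)
    where
    -My≈-μy : ∀ i → sum (λ j → M i j * - y j) ≈ μ * - y i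
    -My≈-μy i = trans (sum-cong-≋ (λ j →
        solve 2 (λ m y → m :* (:- y) := (:- :# 1) :* (m :* y)) refl (M i j) (y j)))
      (trans (sym (*-distribˡ-sum (- 1#) (λ j → M i j * y j)))
      (trans (*-congˡ (My≈μy i)) (solve 2 (λ μ y → (:- :# 1) :* (μ :* y) := μ :* (:- y)) refl μ (y i))))

  -- Row sums as sums over neighbours

  total : List Carrier → Carrier
  total = foldr _+_ 0#

  total-↭ : ∀ {A : Set} (w : A → Carrier) {xs ys} → xs ↭ ys → total (map w xs) ≈ total (map w ys)
  total-↭ w _↭_.refl = refl
  total-↭ w (_↭_.prep x p) = +-congˡ (total-↭ w p)
  total-↭ w (_↭_.swap x y p) = trans (+-congˡ (+-congˡ (total-↭ w p)))
    (solve 3 (λ a b t → a :+ (b :+ t) := b :+ (a :+ t)) refl (w x) (w y) _)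
  total-↭ w (_↭_.trans p q) = trans (total-↭ w p) (total-↭ w q)

  sum-diagonal : ∀ {n} d (x : Fin n → Carrier) i →
    sum (λ j → (if does (i Fin.≟ j) then d else 0#) * x j) ≈ d * x i
  sum-diagonal {suc n} d x zero = trans (+-congˡ (zeros (λ j → x (suc j)))) (+-identityʳ _)
    where
    zeros : ∀ {n} (x : Fin n → Carrier) → sum (λ j → 0# * x j) ≈ 0#
    zeros {zero}  x = refl
    zeros {suc n} x = trans (+-cong (trans (*-comm _ _) (zeroʳ _)) (zeros (λ j → x (suc j)))) (+-identityˡ 0#)
  sum-diagonal {suc n} d x (suc i) = trans
    (+-cong (trans (*-comm _ _) (zeroʳ _)) (sum-diagonal d (λ j → x (suc j)) i)) (+-identityˡ _)

  -- An arbitrary `f` in place of the identity lets the induction pass to the tail of `tabulate f`.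
  sum-indicator : ∀ {n p} {A : Set} {P : Pred A p} (P? : Decidable P) (f : Fin n → A) (x : A → Carrier) →
    sum (λ j → (if does (P? (f j)) then 1# else 0#) * x (f j)) ≈ total (map x (filter P? (tabulate f)))
  sum-indicator {zero}  P? f x = refl
  sum-indicator {suc n} P? f x with does (P? (f zero))
  ... | true  = +-cong (*-identityˡ _) (sum-indicator P? (λ j → f (suc j)) x)
  ... | false = trans
    (+-cong (trans (*-comm _ _) (zeroʳ _)) (sum-indicator P? (λ j → f (suc j)) x)) (+-identityˡ _)

  Aα-row : ∀ {n} (G : Graph n) α (x : Fin n → Carrier) i →
    sum (λ j → Aα α G i j * x j) ≈
    α * (fromℕ (length (neighbours G i)) * x i) + (1# - α) * total (map x (neighbours G i))
  Aα-row G α x i = trans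
    (sum-cong-≋ (λ j → solve 5
      (λ a b d e x → (a :* d :+ b :* e) :* x := a :* (d :* x) :+ b :* (e :* x)) refl
      α (1# - α) (degreeMatrix G i j) (adjacencyMatrix G i j) (x j)))
    (trans (∑-distrib-+ (λ j → α * (degreeMatrix G i j * x j))
                        (λ j → (1# - α) * (adjacencyMatrix G i j * x j)))
    (+-cong
      (trans (sym (*-distribˡ-sum α (λ j → degreeMatrix G i j * x j)))
        (*-congˡ (sum-diagonal (fromℕ (degree G i)) x i)))
      (trans (sym (*-distribˡ-sum (1# - α) (λ j → adjacencyMatrix G i j * x j)))
        (*-congˡ (sum-indicator (Graph._~?_ G i) id x)))))

  fromℕ-nonneg : ∀ n → 0# ≤ fromℕ n
  fromℕ-nonneg zero    = ≤-refl
  fromℕ-nonneg (suc n) = inj₁ (+-pos-≤ 0<1 (fromℕ-nonneg n))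

  Aα-nonneg : ∀ {n} (G : Graph n) {α} → 0# ≤ α → 0# ≤ 1# - α → ∀ i j → 0# ≤ Aα α G i j
  Aα-nonneg G 0≤α 0≤1-α i j = ≤-trans (inj₂ (sym (+-identityˡ 0#)))
    (+-mono-≤ (*-nonneg 0≤α degree≥0) (*-nonneg 0≤1-α adjacency≥0))
    where
    degree≥0 : 0# ≤ degreeMatrix G i j
    degree≥0 with does (i Fin.≟ j)
    ... | true  = fromℕ-nonneg (degree G i)
    ... | false = ≤-refl

    adjacency≥0 : 0# ≤ adjacencyMatrix G i j
    adjacency≥0 with does (Graph._~?_ G i j)
    ... | true  = inj₁ 0<1
    ... | false = ≤-refl

  -- The inequality at each vertex

  module _ {t s N} (0<s : 0# < s) (S : Supersolution t s N) where
    open Supersolution S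

    -- A vertex with fewer children trades their weights for diagonal slack.
    level-inequality : ∀ {ls j} → NeighbourLevels ls j → length ls ℕ.≤ 3 → All (ℕ._≤ N) ls → j ℕ.≤ N →
      total (map weight ls) + s * (fromℕ (length ls) * weight j) < (t + fromℕ 3 * s) * weight j
    level-inequality {ls} (on-cycle m p) len≤3 ls≤N _ =
      <-respˡ-≈ (sym (+-cong (total-↭ weight p)
          (*-congˡ (*-congʳ (reflexive (≡.cong fromℕ (↭-length p)))))))
        (bound m (≡.subst (ℕ._≤ 3) (↭-length p) len≤3))
      where
      w₀ = weight 0
      w₁ = weight 1

      bound : ∀ m → 2 ℕ.+ length (replicate m 1) ℕ.≤ 3 →
        w₀ + (w₀ + total (map weight (replicate m 1))) + s * (fromℕ (2 ℕ.+ length (replicate m 1)) * w₀)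
        < (t + fromℕ 3 * s) * w₀
      bound 0 _ = <-cert (+-pos (<⇒0<- root) (+-pos (pos 1) (*-pos 0<s (pos 0))))
        (solve 4 (λ t s w v → (t :+ :# 3 :* s) :* w
          := (w :+ (w :+ :# 0)) :+ s :* (:# 2 :* w)
             :+ ((t :* w :- (:# 2 :* w :+ v)) :+ (v :+ s :* w))) refl t s w₀ w₁)
      bound 1 _ = <-cert (<⇒0<- root)
        (solve 4 (λ t s w v → (t :+ :# 3 :* s) :* w
          := (w :+ (w :+ (v :+ :# 0))) :+ s :* (:# 3 :* w) :+ (t :* w :- (:# 2 :* w :+ v))) refl t s w₀ w₁)
      bound (suc (suc m)) (ℕ.s≤s (ℕ.s≤s (ℕ.s≤s ())))
    level-inequality {ls} (off-cycle {j} m p) len≤3 ls≤N j<N =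
      <-respˡ-≈ (sym (+-cong (total-↭ weight p)
          (*-congˡ (*-congʳ (reflexive (≡.cong fromℕ (↭-length p)))))))
        (bound m (≡.subst (ℕ._≤ 3) (↭-length p) len≤3) (All-resp-↭ p ls≤N))
      where
      u = weight j
      w = weight (suc j)
      v = weight (2 ℕ.+ j)

      bound : ∀ m → 1 ℕ.+ length (replicate m (2 ℕ.+ j)) ℕ.≤ 3 →
        All (ℕ._≤ N) (j ∷ replicate m (2 ℕ.+ j)) →
        u + total (map weight (replicate m (2 ℕ.+ j)))
          + s * (fromℕ (1 ℕ.+ length (replicate m (2 ℕ.+ j))) * w)
        < (t + fromℕ 3 * s) * w
      -- A childless vertex needs `leaf` only at distance N; closer to the cycle `inner` applies
      -- with room to spare.
      bound 0 _ _ with ℕ.m≤n⇒m<n∨m≡n j<N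
      ... | inj₂ j≡N = <-cert (<⇒0<- (leaf j j≡N))
        (solve 4 (λ t s u w → (t :+ :# 3 :* s) :* w
          := (u :+ :# 0) :+ s :* ((:# 1 :+ :# 0) :* w) :+ ((t :+ :# 2 :* s) :* w :- u)) refl t s u w)
      ... | inj₁ j<N = <-cert
        (+-pos (<⇒0<- (inner j j<N)) (+-pos (*-pos 0<2 (pos (2 ℕ.+ j))) (*-pos 0<2 (*-pos 0<s (pos (suc j))))))
        (solve 5 (λ t s u w v → (t :+ :# 3 :* s) :* w
          := (u :+ :# 0) :+ s :* ((:# 1 :+ :# 0) :* w)
             :+ ((t :* w :- (u :+ :# 2 :* v)) :+ (:# 2 :* v :+ :# 2 :* (s :* w)))) refl t s u w v)
      -- The child has distance 2 + j, at most N, which places the vertex itself strictly below N as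
      -- `inner` demands.
      bound 1 _ (_ ∷ j<N ∷ []) = <-cert
        (+-pos (<⇒0<- (inner j j<N)) (+-pos (pos (2 ℕ.+ j)) (*-pos 0<s (pos (suc j)))))
        (solve 5 (λ t s u w v → (t :+ :# 3 :* s) :* w
          := (u :+ (v :+ :# 0)) :+ s :* (:# 2 :* w)
             :+ ((t :* w :- (u :+ :# 2 :* v)) :+ (v :+ s :* w))) refl t s u w v)
      bound 2 _ (_ ∷ j<N ∷ _) = <-cert (<⇒0<- (inner j j<N))
        (solve 5 (λ t s u w v → (t :+ :# 3 :* s) :* w
          := (u :+ (v :+ (v :+ :# 0))) :+ s :* (:# 3 :* w)
             :+ (t :* w :- (u :+ :# 2 :* v))) refl t s u w v)
      bound (suc (suc (suc m))) (ℕ.s≤s (ℕ.s≤s (ℕ.s≤s ()))) _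

  -- Multiplying the level inequalities by 1 - α turns (1 - α) s into α, so the weights bound the
  -- rows of `Aα`. All levels are at most `N`, since k is `suc N`.
  spectral-radius-bound : ∀ {n} {G : Graph n} (U : IsUnicyclic G) → maxDegree G ≡ 3 →
    ∀ {t s α N} → 0# < s → 0# < 1# - α → (1# - α) * s ≈ α → Supersolution t s N → IsK U (suc N) →
    ∀ {ρ} → IsSpectralRadius (Aα α G) ρ → ρ < fromℕ 3 * α + (1# - α) * t
  spectral-radius-bound {n} {G} U Δ≡3 {t} {s} {α} {N} 0<s 0<β βs≈α S isK (eigenvalue , _) =
    eigenvalue-bound {x = x} (Aα-nonneg G 0≤α (inj₁ 0<β)) (λ v → pos (level v)) row eigenvalue
    where
    open Supersolution S
    open Levels U

    x : Fin n → Carrier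
    x v = weight (level v)

    0≤α : 0# ≤ α
    0≤α = inj₁ (<-respʳ-≈ βs≈α (*-pos 0<β 0<s))

    level≤N : ∀ v → level v ℕ.≤ N
    level≤N v = ℕ.s≤s⁻¹ (level-bound isK v)

    row : ∀ v → sum (λ w → Aα α G v w * x w) < (fromℕ 3 * α + (1# - α) * t) * x v
    row v = <-respˡ-≈ lhs (<-respʳ-≈ rhs (*-monoˡ-< (1# - α) 0<β
        (level-inequality 0<s S (neighbour-levels v) len≤3 (All.map⁺ (All.universal level≤N ns)) (level≤N v))))
      where
      ns = neighbours G v

      len≡ : length (map level ns) ≡ length ns
      len≡ = length-map level ns

      len≤3 : length (map level ns) ℕ.≤ 3
      len≤3 = ≡.subst₂ ℕ._≤_ (≡.sym len≡) Δ≡3 (≤-foldr-⊔ (degree G) v)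

      d = fromℕ (length ns)

      lhs : (1# - α) * (total (map weight (map level ns)) + s * (fromℕ (length (map level ns)) * x v))
          ≈ sum (λ w → Aα α G v w * x w)
      lhs = trans
        (*-congˡ (+-cong (reflexive (≡.cong total (≡.sym (map-∘ ns))))
          (*-congˡ (*-congʳ (reflexive (≡.cong fromℕ len≡))))))
        (trans (solve 4 (λ b σ s y → b :* (σ :+ s :* y) := b :* s :* y :+ b :* σ) refl
            (1# - α) (total (map x ns)) s (d * x v))
        (trans (+-congʳ (*-congʳ βs≈α)) (sym (Aα-row G α x v))))

      rhs : (1# - α) * ((t + fromℕ 3 * s) * x v) ≈ (fromℕ 3 * α + (1# - α) * t) * x v
      rhs = trans (solve 4 (λ b t s y → b :* ((t :+ :# 3 :* s) :* y) := (:# 3 :* (b :* s) :+ b :* t) :* y)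
          refl (1# - α) t s (x v))
        (*-congʳ (+-congʳ (*-congˡ βs≈α)))

  -- If γ ≥ 2, then the hypothesis carries no information (at γ = 2 the quotient
  -- is even a junk value), but the conclusion holds because s is positive.
  threshold : ∀ {γ α s} → 0# < s → 0# < 1# - α → (1# - α) * s ≈ α →
    (- γ) / (fromℕ 2 - γ) < α → - (fromℕ 2 * s) < γ
  threshold {γ} {α} {s} 0<s 0<β βs≈α h with compare γ (fromℕ 2)
  ... | tri≈ _ γ≈2 _ = <-respʳ-≈ (sym γ≈2) (<-cert (+-pos 0<2 (*-pos 0<2 0<s))
    (solve 1 (λ s → :# 2 := :- (:# 2 :* s) :+ (:# 2 :+ :# 2 :* s)) refl s))
  ... | tri> _ _ γ>2 = <-cert (+-pos (<-trans 0<2 γ>2) (*-pos 0<2 0<s))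
    (solve 2 (λ γ s → γ := :- (:# 2 :* s) :+ (γ :+ :# 2 :* s)) refl γ s)
  ... | tri< γ<2 _ _ = 0<-⇒< (*-cancelˡ-< (1# - α) (inj₁ 0<β)
    (<-respˡ-≈ (sym (zeroʳ _)) (0<-by (<⇒0<- (*-monoˡ-< e 0<e h)) identity)))
    where
    e = fromℕ 2 - γ
    0<e : 0# < e
    0<e = <⇒0<- γ<2

    -- Multiplied by 2 - γ, the hypothesis says 0 < (1 - α) γ + 2α, and here α = (1 - α) s.
    identity : (1# - α) * (γ - - (fromℕ 2 * s)) ≈ e * α - e * ((- γ) / e)
    identity = trans (solve 3 (λ α γ s → (:# 1 :- α) :* (γ :- (:- (:# 2 :* s)))
          := γ :- α :* γ :+ :# 2 :* ((:# 1 :- α) :* s)) refl α γ s)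
      (trans (+-congˡ (*-congˡ βs≈α))
      (trans (solve 2 (λ α γ → γ :- α :* γ :+ :# 2 :* α := (:# 2 :- γ) :* α :- (:- γ) :* :# 1) refl α γ)
      (+-congˡ (-‿cong (trans (*-congˡ (sym (*-inverseʳ e (0<⇒≉0 0<e))))
        (solve 3 (λ g e i → g :* (e :* i) := e :* (g :* i)) refl (- γ) e (e ⁻¹)))))))

mainTheorem12 : ∀ {c ℓ₁ ℓ₂} (ℝ : CompleteOrderedField c ℓ₁ ℓ₂) →
    let open CompleteOrderedField ℝ
        open Analysis ℝ
        open Spectral ℝ
        open AαMatrix ℝ
    in
    (√2 : Carrier) → IsSqrt (fromℕ 2) √2 →
    (cos : Carrier → Carrier) → IsCosine cos →
    (π : Carrier) → IsPi cos π →
    (γ₀ : Carrier) → IsSpectralRadius (Z √2 γ₀) (fromℕ 2 * √2 * cos (π / fromℕ 7)) →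
    (δ₀ : Carrier) → IsSpectralRadius (W δ₀) (fromℕ 2 * √2 * cos (π / fromℕ 5)) →
    ∀ {n} (G : Graph n) (U : IsUnicyclic G) → maxDegree G ≡ 3 →
    (α : Carrier) → 0# < α → α < 1# →
    (k : ℕ) → IsK U k →
    (k ≡ 3 × (- γ₀) / (fromℕ 2 - γ₀) < α) ⊎ (k ≡ 2 × (- δ₀) / (fromℕ 2 - δ₀) < α) →
    (ρ : Carrier) → IsSpectralRadius (Aα α G) ρ →
    ρ < fromℕ 3 * α + fromℕ 2 * (1# - α) * √2 * cos (π / fromℕ (2 ℕ.* k ℕ.+ 1))
mainTheorem12 ℝ √2 (0≤√2 , √2²≈2) cos _ π _ γ₀ ρ[Z] δ₀ ρ[W] G U Δ≡3 α 0<α α<1 k isK cases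
  ρ ρ[A] = main cases isK
  where
  open CompleteOrderedField ℝ
  open OrderedField ℝ
  open LevelWeights ℝ
  open WeightedRowSums ℝ

  0<β : 0# < 1# - α
  0<β = <⇒0<- α<1

  s = α / (1# - α)

  0<s : 0# < s
  0<s = *-pos 0<α (⁻¹-pos 0<β)

  βs≈α : (1# - α) * s ≈ α
  βs≈α = trans (solve 3 (λ b a i → b :* (a :* i) := a :* (b :* i)) refl (1# - α) α ((1# - α) ⁻¹))
    (trans (*-congˡ (*-inverseʳ (1# - α) (0<⇒≉0 0<β))) (*-identityʳ α))

  0<√2 : 0# < √2
  0<√2 = [ id , (λ e →
    ⊥-elim (0<⇒≉0 0<2 (trans (sym √2²≈2) (trans (*-congˡ (sym e)) (zeroʳ √2))))) ]′ 0≤√2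

  bound : ∀ {N x} → Supersolution (fromℕ 2 * √2 * x) s N → IsK U (suc N) →
          ρ < fromℕ 3 * α + fromℕ 2 * (1# - α) * √2 * x
  bound {x = x} S isK = <-respʳ-≈
    (+-congˡ (solve 3 (λ b r x → b :* (:# 2 :* r :* x) := :# 2 :* b :* r :* x) refl (1# - α) √2 x))
    (spectral-radius-bound U Δ≡3 0<s 0<β βs≈α S isK ρ[A])

  main : (k ≡ 3 × (- γ₀) / (fromℕ 2 - γ₀) < α) ⊎ (k ≡ 2 × (- δ₀) / (fromℕ 2 - δ₀) < α) → IsK U k →
         ρ < fromℕ 3 * α + fromℕ 2 * (1# - α) * √2 * cos (π / fromℕ (2 ℕ.* k ℕ.+ 1))
  -- With k equal to 3 or 2 the denominator 2k + 1 computes to 7 or 5, so the bound speaks of the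
  -- given spectral radius of `Z` or `W`.
  main (inj₁ (≡.refl , h)) = bound (Z-supersolution 0<√2 √2²≈2 ρ[Z] (threshold 0<s 0<β βs≈α h))
  main (inj₂ (≡.refl , h)) = bound (W-supersolution ρ[W] (threshold 0<s 0<β βs≈α h))
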